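{- There is an absolute constant $C>0$ such that the following holds. Let $p$ be a prime, let $\mathcal{U},\mathcal{V}\subset\{0,1,\ldots,p-1\}$ be sets with $u$ and $v$ elements respectively, and let $S$ and $T$ be any integers with $1\le T\le p$. Let $J_2$ denote the number of triples of integers $(x,y,z)$ satisfying $$xy\equiv z\pmod p,\qquad x\in\mathcal{U},\quad y\in\mathcal{V},\quad S+1\le z\le S+T.$$ Then $$\left|J_2-\frac{uvT}{p}\right|\le C\left((u^2v^2T)^{1/3}+(puv)^{1/2}\right).$$ -}

module Defs where

open import Data.Fin using (Fin; toℕ)
open import Data.Fin.Properties using (any?; toℕ-injective)
open import Data.Fin.Subset using (Subset; _∈_)
open import Data.Fin.Subset.Properties using (_∈?_)
open import Data.Integer as ℤ using (ℤ; +_)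
import Data.Integer.Properties as ℤP
open import Data.Integer.Divisibility.Signed using (_∣_; _∣?_)
open import Data.Integer.Solver using () renaming (module +-*-Solver to ℤ-Solver)
open import Data.List using (List; length; map; filter; cartesianProduct; allFin; upTo)
import Data.List.Membership.Propositional as List
open import Data.List.Membership.Propositional.Properties
  using (∈-map⁺; ∈-filter⁺; ∈-filter⁻; ∈-cartesianProduct⁺; ∈-allFin; ∈-upTo⁺)
open import Data.List.Relation.Unary.Unique.Propositional using (Unique)
import Data.List.Relation.Unary.Unique.Propositional.Properties as Unique
open import Data.Nat as ℕ using (ℕ; zero; suc; NonZero; z≤n; s≤s)
import Data.Nat.Properties as ℕP
open import Data.Nat.Solver using () renaming (module +-*-Solver to ℕ-Solver)
open import Data.Product using (Σ-syntax; ∃-syntax; _×_; _,_; proj₁; proj₂)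
open import Data.Rational using
  (ℚ; mkℚ; _+_; _-_; _*_; -_; ∣_∣; _≤_; _<_; 0ℚ; 1ℚ; ½; _/_; toℚᵘ; *<*; *≤*)
import Data.Rational as ℚ
import Data.Rational.Properties as ℚP
open import Data.Rational.Solver using () renaming (module +-*-Solver to ℚ-Solver)
open import Data.Rational.Unnormalised as ℚᵘ using (mkℚᵘ; *≡*)
import Data.Rational.Unnormalised.Properties as ℚᵘP
open import Data.Sum using (inj₁; inj₂)
open import Function using (_∘_; _⇔_; mk⇔)
open import Relation.Binary.PropositionalEquality
  using (_≡_; refl; sym; trans; cong; cong₂; subst; subst₂)
open import Relation.Nullary using (Dec; yes; no)
open import Relation.Nullary.Decidable using (_×-dec_)
open import Relation.Unary using (Decidable)

------------------------------------------------------------------------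
-- Real numbers as Cauchy sequences of rationals

IsCauchy : (ℕ → ℚ) → Set
IsCauchy x = ∀ ε → 0ℚ < ε →
  ∃[ N ] (∀ m n → N ℕ.≤ m → N ℕ.≤ n → ∣ x m - x n ∣ < ε)

record ℝ : Set where
  constructor mkℝ
  field
    seq    : ℕ → ℚ
    cauchy : IsCauchy seq

open ℝ public

infix 4 _≤ℝ_ _<ℝ_

-- Distinct Cauchy sequences may represent the same real, so both orders
-- compare tails only, up to (respectively, with a gap of) a rational ε > 0.

_≤ℝ_ : ℝ → ℝ → Set
x ≤ℝ y = ∀ ε → 0ℚ < ε → ∃[ N ] (∀ n → N ℕ.≤ n → seq x n ≤ seq y n + ε)

_<ℝ_ : ℝ → ℝ → Set
x <ℝ y = ∃[ ε ] 0ℚ < ε × ∃[ N ] (∀ n → N ℕ.≤ n → seq x n + ε ≤ seq y n)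

private
  half-pos : ∀ {ε} → 0ℚ < ε → 0ℚ < ½ * ε
  half-pos {ε} 0<ε = subst (_< ½ * ε) (ℚP.*-zeroʳ ½) (ℚP.*-monoʳ-<-pos ½ 0<ε)

  half+half : ∀ ε → ½ * ε + ½ * ε ≡ ε
  half+half ε = trans (sym (ℚP.*-distribʳ-+ ε ½ ½)) (ℚP.*-identityˡ ε)

fromℚ : ℚ → ℝ
fromℚ q = mkℝ (λ _ → q) λ ε 0<ε →
  0 , λ _ _ _ _ → subst (_< ε) (sym (cong ∣_∣ (ℚP.+-inverseʳ q))) 0<ε

fromℕ : ℕ → ℝ
fromℕ n = fromℚ (+ n / 1)

0ℝ : ℝ
0ℝ = fromℚ 0ℚ

infixl 6 _+ℝ_ _-ℝ_
infixl 7 _*ℝ_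
infix  8 -ℝ_

_+ℝ_ : ℝ → ℝ → ℝ
x +ℝ y = mkℝ (λ n → seq x n + seq y n) λ ε 0<ε →
  let (M , p) = cauchy x (½ * ε) (half-pos 0<ε)
      (N , q) = cauchy y (½ * ε) (half-pos 0<ε)
  in M ℕ.⊔ N , λ m n ≤m ≤n → begin-strict
    ∣ (seq x m + seq y m) - (seq x n + seq y n) ∣
      ≡⟨ cong ∣_∣ (interchange (seq x m) (seq y m) (seq x n) (seq y n)) ⟩
    ∣ (seq x m - seq x n) + (seq y m - seq y n) ∣
      ≤⟨ ℚP.∣p+q∣≤∣p∣+∣q∣ (seq x m - seq x n) (seq y m - seq y n) ⟩
    ∣ seq x m - seq x n ∣ + ∣ seq y m - seq y n ∣
      <⟨ ℚP.+-mono-< (p m n (ℕP.m⊔n≤o⇒m≤o M N ≤m) (ℕP.m⊔n≤o⇒m≤o M N ≤n))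
                     (q m n (ℕP.m⊔n≤o⇒n≤o M N ≤m) (ℕP.m⊔n≤o⇒n≤o M N ≤n)) ⟩
    ½ * ε + ½ * ε ≡⟨ half+half ε ⟩
    ε ∎
  where
  open ℚP.≤-Reasoning
  interchange : ∀ a b c d → (a + b) - (c + d) ≡ (a - c) + (b - d)
  interchange = solve 4 (λ a b c d → (a :+ b) :- (c :+ d) := (a :- c) :+ (b :- d)) refl
    where open ℚ-Solver

-ℝ_ : ℝ → ℝ
-ℝ x = mkℝ (λ n → - seq x n) λ ε 0<ε →
  let (N , p) = cauchy x ε 0<ε
  in N , λ m n ≤m ≤n →
    subst (_< ε)
      (trans (sym (ℚP.∣-p∣≡∣p∣ (seq x m - seq x n)))
             (cong ∣_∣ (ℚP.neg-distrib-+ (seq x m) (- seq x n))))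
      (p m n ≤m ≤n)

_-ℝ_ : ℝ → ℝ → ℝ
x -ℝ y = x +ℝ (-ℝ y)

private
  ∣∣-lipschitz : ∀ p q → ∣ ∣ p ∣ - ∣ q ∣ ∣ ≤ ∣ p - q ∣
  ∣∣-lipschitz p q with ℚP.∣p∣≡p∨∣p∣≡-p (∣ p ∣ - ∣ q ∣)
  ... | inj₁ e = subst (_≤ ∣ p - q ∣) (sym e) (one-sided p q)
    where
    one-sided : ∀ p q → ∣ p ∣ - ∣ q ∣ ≤ ∣ p - q ∣
    one-sided p q = begin
      ∣ p ∣ - ∣ q ∣                 ≡⟨ cong (λ r → ∣ r ∣ - ∣ q ∣) (split p q) ⟩
      ∣ (p - q) + q ∣ - ∣ q ∣       ≤⟨ ℚP.+-monoˡ-≤ (- ∣ q ∣) (ℚP.∣p+q∣≤∣p∣+∣q∣ (p - q) q) ⟩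
      ∣ p - q ∣ + ∣ q ∣ - ∣ q ∣     ≡⟨ drop ∣ p - q ∣ ∣ q ∣ ⟩
      ∣ p - q ∣                     ∎
      where
      open ℚP.≤-Reasoning
      open ℚ-Solver
      split : ∀ p q → p ≡ (p - q) + q
      split = solve 2 (λ p q → p := (p :- q) :+ q) refl
      drop : ∀ a b → a + b - b ≡ a
      drop = solve 2 (λ a b → a :+ b :- b := a) refl
  ... | inj₂ e = subst (_≤ ∣ p - q ∣) (sym e) (begin
      - (∣ p ∣ - ∣ q ∣)             ≡⟨ flip ∣ p ∣ ∣ q ∣ ⟩
      ∣ q ∣ - ∣ p ∣                 ≡⟨ cong (λ r → ∣ r ∣ - ∣ p ∣) (split p q) ⟩
      ∣ p - (p - q) ∣ - ∣ p ∣       ≤⟨ ℚP.+-monoˡ-≤ (- ∣ p ∣) (ℚP.∣p-q∣≤∣p∣+∣q∣ p (p - q)) ⟩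
      ∣ p ∣ + ∣ p - q ∣ - ∣ p ∣     ≡⟨ drop ∣ p ∣ ∣ p - q ∣ ⟩
      ∣ p - q ∣                     ∎)
    where
    open ℚP.≤-Reasoning
    open ℚ-Solver
    flip : ∀ a b → - (a - b) ≡ b - a
    flip = solve 2 (λ a b → :- (a :- b) := b :- a) refl
    split : ∀ p q → q ≡ p - (p - q)
    split = solve 2 (λ p q → q := p :- (p :- q)) refl
    drop : ∀ a b → a + b - a ≡ b
    drop = solve 2 (λ a b → a :+ b :- a := b) refl

∣_∣ℝ : ℝ → ℝ
∣ x ∣ℝ = mkℝ (λ n → ∣ seq x n ∣) λ ε 0<ε →
  let (N , p) = cauchy x ε 0<ε
  in N , λ m n ≤m ≤n → ℚP.≤-<-trans (∣∣-lipschitz (seq x m) (seq x n)) (p m n ≤m ≤n)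

private
  bounded : (x : ℝ) → ∃[ B ] 0ℚ < B × ∃[ N ] (∀ n → N ℕ.≤ n → ∣ seq x n ∣ ≤ B)
  bounded x with cauchy x 1ℚ (ℚP.positive⁻¹ 1ℚ)
  ... | N , p = 1ℚ + ∣ seq x N ∣
      , ℚP.+-mono-<-≤ (ℚP.positive⁻¹ 1ℚ) (ℚP.0≤∣p∣ (seq x N))
      , N , λ n N≤n → begin
        ∣ seq x n ∣                           ≡⟨ cong ∣_∣ (split (seq x n) (seq x N)) ⟩
        ∣ (seq x n - seq x N) + seq x N ∣     ≤⟨ ℚP.∣p+q∣≤∣p∣+∣q∣ (seq x n - seq x N) (seq x N) ⟩
        ∣ seq x n - seq x N ∣ + ∣ seq x N ∣   ≤⟨ ℚP.+-monoˡ-≤ ∣ seq x N ∣ (ℚP.<⇒≤ (p n N N≤n ℕP.≤-refl)) ⟩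
        1ℚ + ∣ seq x N ∣                      ∎
    where
    open ℚP.≤-Reasoning
    split : ∀ p q → p ≡ (p - q) + q
    split = solve 2 (λ p q → p := (p :- q) :+ q) refl
      where open ℚ-Solver

_*ℝ_ : ℝ → ℝ → ℝ
x *ℝ y = mkℝ (λ n → seq x n * seq y n) λ ε 0<ε →
  let (B , 0<B , K , ∣x∣≤B) = bounded x
      (D , 0<D , L , ∣y∣≤D) = bounded y
      instance
        B-pos = ℚ.positive 0<B
        D-pos = ℚ.positive 0<D
        B+D-pos = ℚP.pos+pos⇒pos B D
        B+D≢0 = ℚP.pos⇒nonZero (B + D)
        1/-pos = ℚP.1/pos⇒pos (B + D)
      δ = ℚ.1/ (B + D) * ε
      0<δ = subst (_< δ) (ℚP.*-zeroʳ (ℚ.1/ (B + D))) (ℚP.*-monoʳ-<-pos (ℚ.1/ (B + D)) 0<ε)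
      (M , p) = cauchy x δ 0<δ
      (N , q) = cauchy y δ 0<δ
      P = (K ℕ.⊔ L) ℕ.⊔ (M ℕ.⊔ N)
      K≤ = λ {n} (h : P ℕ.≤ n) → ℕP.m⊔n≤o⇒m≤o K L (ℕP.m⊔n≤o⇒m≤o (K ℕ.⊔ L) (M ℕ.⊔ N) h)
      L≤ = λ {n} (h : P ℕ.≤ n) → ℕP.m⊔n≤o⇒n≤o K L (ℕP.m⊔n≤o⇒m≤o (K ℕ.⊔ L) (M ℕ.⊔ N) h)
      M≤ = λ {n} (h : P ℕ.≤ n) → ℕP.m⊔n≤o⇒m≤o M N (ℕP.m⊔n≤o⇒n≤o (K ℕ.⊔ L) (M ℕ.⊔ N) h)
      N≤ = λ {n} (h : P ℕ.≤ n) → ℕP.m⊔n≤o⇒n≤o M N (ℕP.m⊔n≤o⇒n≤o (K ℕ.⊔ L) (M ℕ.⊔ N) h)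
  in P , λ m n ≤m ≤n →
    let dx = seq x m - seq x n
        dy = seq y m - seq y n
        instance
          dx-nn = ℚP.∣-∣-nonNeg dx
          dy-nn = ℚP.∣-∣-nonNeg dy
    in begin-strict
    ∣ seq x m * seq y m - seq x n * seq y n ∣
      ≡⟨ cong ∣_∣ (expand (seq x m) (seq y m) (seq x n) (seq y n)) ⟩
    ∣ seq x m * dy + seq y n * dx ∣
      ≤⟨ ℚP.∣p+q∣≤∣p∣+∣q∣ (seq x m * dy) (seq y n * dx) ⟩
    ∣ seq x m * dy ∣ + ∣ seq y n * dx ∣
      ≡⟨ cong₂ _+_ (ℚP.∣p*q∣≡∣p∣*∣q∣ (seq x m) dy) (ℚP.∣p*q∣≡∣p∣*∣q∣ (seq y n) dx) ⟩
    ∣ seq x m ∣ * ∣ dy ∣ + ∣ seq y n ∣ * ∣ dx ∣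
      ≤⟨ ℚP.+-mono-≤ (ℚP.*-monoʳ-≤-nonNeg ∣ dy ∣ (∣x∣≤B m (K≤ ≤m)))
                     (ℚP.*-monoʳ-≤-nonNeg ∣ dx ∣ (∣y∣≤D n (L≤ ≤n))) ⟩
    B * ∣ dy ∣ + D * ∣ dx ∣
      <⟨ ℚP.+-mono-< (ℚP.*-monoʳ-<-pos B (q m n (N≤ ≤m) (N≤ ≤n)))
                     (ℚP.*-monoʳ-<-pos D (p m n (M≤ ≤m) (M≤ ≤n))) ⟩
    B * δ + D * δ
      ≡⟨ regroup B D (ℚ.1/ (B + D)) ε ⟩
    ((B + D) * ℚ.1/ (B + D)) * ε
      ≡⟨ cong (_* ε) (ℚP.*-inverseʳ (B + D)) ⟩
    1ℚ * ε
      ≡⟨ ℚP.*-identityˡ ε ⟩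
    ε ∎
  where
  open ℚP.≤-Reasoning
  open ℚ-Solver
  expand : ∀ a b c d → a * b - c * d ≡ a * (b - d) + d * (a - c)
  expand = solve 4 (λ a b c d → a :* b :- c :* d := a :* (b :- d) :+ d :* (a :- c)) refl
  regroup : ∀ b d i e → b * (i * e) + d * (i * e) ≡ ((b + d) * i) * e
  regroup = solve 4 (λ b d i e → b :* (i :* e) :+ d :* (i :* e) := ((b :+ d) :* i) :* e) refl

------------------------------------------------------------------------
-- Real k-th roots of natural numbers

-- For k ≥ 1, the integer part of the k-th root.
iroot : ℕ → ℕ → ℕ
iroot k zero    = 0
iroot k (suc a) with suc (iroot k a) ℕ.^ k ℕ.≤? suc a
... | yes _ = suc (iroot k a)
... | no  _ = iroot k a

iroot-lower : ∀ k .{{_ : NonZero k}} a → iroot k a ℕ.^ k ℕ.≤ a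
iroot-lower (suc k) zero = z≤n
iroot-lower k@(suc _) (suc a) with suc (iroot k a) ℕ.^ k ℕ.≤? suc a
... | yes h = h
... | no  _ = ℕP.m≤n⇒m≤1+n (iroot-lower k a)

iroot-upper : ∀ k .{{_ : NonZero k}} a → a ℕ.< suc (iroot k a) ℕ.^ k
iroot-upper k zero = subst (ℕ._< 1 ℕ.^ k) refl (ℕP.m^n>0 1 k)
iroot-upper k (suc a) with suc (iroot k a) ℕ.^ k ℕ.≤? suc a
... | yes _ = ℕP.<-≤-trans (s≤s (iroot-upper k a)) (ℕP.^-monoˡ-< k (ℕP.n<1+n _))
... | no  h = ℕP.≰⇒> h

private
  ^-distribʳ-* : ∀ k m n → (m ℕ.* n) ℕ.^ k ≡ m ℕ.^ k ℕ.* n ℕ.^ k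
  ^-distribʳ-* zero    m n = refl
  ^-distribʳ-* (suc k) m n = trans (cong (m ℕ.* n ℕ.*_) (^-distribʳ-* k m n))
    (solve 4 (λ a b c d → a :* b :* (c :* d) := a :* c :* (b :* d)) refl m n (m ℕ.^ k) (n ℕ.^ k))
    where open ℕ-Solver

  iroot-scaled-≤ : ∀ k .{{_ : NonZero k}} a M N →
    iroot k (a ℕ.* M ℕ.^ k) ℕ.* N ℕ.≤ suc (iroot k (a ℕ.* N ℕ.^ k)) ℕ.* M
  iroot-scaled-≤ k a M N = ℕP.≮⇒≥ λ h → ℕP.<-irrefl refl (begin-strict
    a ℕ.* M ℕ.^ k ℕ.* N ℕ.^ k              ≡⟨ swap a (M ℕ.^ k) (N ℕ.^ k) ⟩
    a ℕ.* N ℕ.^ k ℕ.* M ℕ.^ k              ≤⟨ ℕP.*-monoˡ-≤ (M ℕ.^ k) (ℕP.<⇒≤ (iroot-upper k (a ℕ.* N ℕ.^ k))) ⟩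
    suc B ℕ.^ k ℕ.* M ℕ.^ k                ≡⟨ ^-distribʳ-* k (suc B) M ⟨
    (suc B ℕ.* M) ℕ.^ k                    <⟨ ℕP.^-monoˡ-< k h ⟩
    (A ℕ.* N) ℕ.^ k                        ≡⟨ ^-distribʳ-* k A N ⟩
    A ℕ.^ k ℕ.* N ℕ.^ k                    ≤⟨ ℕP.*-monoˡ-≤ (N ℕ.^ k) (iroot-lower k (a ℕ.* M ℕ.^ k)) ⟩
    a ℕ.* M ℕ.^ k ℕ.* N ℕ.^ k              ∎)
    where
    open ℕP.≤-Reasoning
    A = iroot k (a ℕ.* M ℕ.^ k)
    B = iroot k (a ℕ.* N ℕ.^ k)
    swap : ∀ a b c → a ℕ.* b ℕ.* c ≡ a ℕ.* c ℕ.* b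
    swap = solve 3 (λ a b c → a :* b :* c := a :* c :* b) refl
      where open ℕ-Solver

  /-mono : ∀ a b m n .{{_ : NonZero m}} .{{_ : NonZero n}} →
           a ℕ.* n ℕ.≤ b ℕ.* m → + a / m ≤ + b / n
  /-mono a b m@(suc _) n@(suc _) h = ℚP.toℚᵘ-cancel-≤ (begin
    toℚᵘ (+ a / m)   ≃⟨ ℚP.toℚᵘ-fromℚᵘ (mkℚᵘ (+ a) _) ⟩
    + a ℚᵘ./ m       ≤⟨ ℚᵘ.*≤* (subst₂ ℤ._≤_ (ℤP.pos-* a n) (ℤP.pos-* b m) (ℤ.+≤+ h)) ⟩
    + b ℚᵘ./ n       ≃⟨ ℚP.toℚᵘ-fromℚᵘ (mkℚᵘ (+ b) _) ⟨
    toℚᵘ (+ b / n)   ∎)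
    where open ℚᵘP.≤-Reasoning

  suc-/ : ∀ b n .{{_ : NonZero n}} → + suc b / n ≡ + b / n + + 1 / n
  suc-/ b n@(suc _) = ℚP.toℚᵘ-injective (begin
    toℚᵘ (+ suc b / n)                 ≈⟨ ℚP.toℚᵘ-fromℚᵘ (mkℚᵘ (+ suc b) _) ⟩
    + suc b ℚᵘ./ n                     ≈⟨ *≡* (cross (+ b) (+ n)) ⟩
    + b ℚᵘ./ n ℚᵘ.+ + 1 ℚᵘ./ n         ≈⟨ ℚᵘP.+-cong (ℚP.toℚᵘ-fromℚᵘ (mkℚᵘ (+ b) _)) (ℚP.toℚᵘ-fromℚᵘ (mkℚᵘ (+ 1) _)) ⟨
    toℚᵘ (+ b / n) ℚᵘ.+ toℚᵘ (+ 1 / n) ≈⟨ ℚP.toℚᵘ-homo-+ (+ b / n) (+ 1 / n) ⟨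
    toℚᵘ (+ b / n + + 1 / n)           ∎)
    where
    open ℚᵘP.≃-Reasoning
    open ℤ-Solver
    cross : ∀ b n → (+ 1 ℤ.+ b) ℤ.* (n ℤ.* n) ≡ (b ℤ.* n ℤ.+ + 1 ℤ.* n) ℤ.* n
    cross = solve 2 (λ b n → (con (+ 1) :+ b) :* (n :* n) := (b :* n :+ con (+ 1) :* n) :* n) refl

  archimedean : ∀ ε → 0ℚ < ε → ∃[ N ] (∀ n → N ℕ.≤ n → + 1 / suc n < ε)
  archimedean (mkℚ (+ zero) d c) (*<* (ℤ.+<+ ()))
  archimedean (mkℚ ℤ.-[1+ _ ] d c) (*<* ())
  archimedean ε@(mkℚ (+ suc a) d _) _ = suc d , λ n sd≤n → ℚP.toℚᵘ-cancel-< (begin-strict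
    toℚᵘ (+ 1 / suc n)   ≃⟨ ℚP.toℚᵘ-fromℚᵘ (mkℚᵘ (+ 1) n) ⟩
    + 1 ℚᵘ./ suc n       <⟨ ℚᵘ.*<* (ℤ.+<+ (ℕP.<-≤-trans
                              (subst (ℕ._< suc n) (sym (ℕP.*-identityˡ (suc d))) (s≤s sd≤n))
                              (ℕP.m≤m+n (suc n) (a ℕ.* suc n)))) ⟩
    toℚᵘ ε               ∎)
    where open ℚᵘP.≤-Reasoning

  ∣-∣-< : ∀ p q ε → p < q + ε → q < p + ε → ∣ p - q ∣ < ε
  ∣-∣-< p q ε h k with ℚP.∣p∣≡p∨∣p∣≡-p (p - q)
  ... | inj₁ e = subst₂ _<_ (sym e) (drop q ε) (ℚP.+-monoˡ-< (- q) h)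
    where
    drop : ∀ q e → q + e - q ≡ e
    drop = solve 2 (λ q e → q :+ e :- q := e) refl
      where open ℚ-Solver
  ... | inj₂ e = subst₂ _<_ (trans (flip p q) (sym e)) (drop p ε) (ℚP.+-monoˡ-< (- p) k)
    where
    open ℚ-Solver
    drop : ∀ q e → q + e - q ≡ e
    drop = solve 2 (λ q e → q :+ e :- q := e) refl
    flip : ∀ p q → q - p ≡ - (p - q)
    flip = solve 2 (λ p q → q :- p := :- (p :- q)) refl

-- The n-th term is the largest multiple of 1 / (n + 1) whose k-th power is
-- at most a.
root : (k : ℕ) .{{_ : NonZero k}} → ℕ → ℝ
root k a = mkℝ r λ ε 0<ε →
  let (N , small) = archimedean ε 0<ε
      near : ∀ m n → N ℕ.≤ n → r m < r n + ε
      near m n N≤n = begin-strict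
        r m                         ≤⟨ /-mono (c m) (suc (c n)) (suc m) (suc n) (iroot-scaled-≤ k a (suc m) (suc n)) ⟩
        + suc (c n) / suc n         ≡⟨ suc-/ (c n) (suc n) ⟩
        r n + + 1 / suc n           <⟨ ℚP.+-monoʳ-< (r n) (small n N≤n) ⟩
        r n + ε                     ∎
  in N , λ m n ≤m ≤n → ∣-∣-< (r m) (r n) ε (near m n ≤n) (near n m ≤m)
  where
  open ℚP.≤-Reasoning
  c : ℕ → ℕ
  c n = iroot k (a ℕ.* suc n ℕ.^ k)
  r : ℕ → ℚ
  r n = + c n / suc n

------------------------------------------------------------------------
-- Counting solutions of x y ≡ z (mod p)

infix 4 _∈ℤ_ _∈ℤ?_

-- A subset of {0, …, p - 1}, viewed as a set of integers.
_∈ℤ_ : ∀ {p} → ℤ → Subset p → Set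
x ∈ℤ U = ∃[ i ] (i ∈ U × x ≡ + toℕ i)

_∈ℤ?_ : ∀ {p} (x : ℤ) (U : Subset p) → Dec (x ∈ℤ U)
x ∈ℤ? U = any? λ i → (i ∈? U) ×-dec (x ℤ.≟ + toℕ i)

module _ (p : ℕ) (U V : Subset p) (S : ℤ) (T : ℕ) where

  IsSolution : ℤ × ℤ × ℤ → Set
  IsSolution (x , y , z) =
    (+ p ∣ x ℤ.* y ℤ.- z) × x ∈ℤ U × y ∈ℤ V ×
    S ℤ.+ + 1 ℤ.≤ z × z ℤ.≤ S ℤ.+ + T

  isSolution? : Decidable IsSolution
  isSolution? (x , y , z) =
    (+ p ∣? x ℤ.* y ℤ.- z) ×-dec (x ∈ℤ? U) ×-dec (y ∈ℤ? V) ×-dec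
    (S ℤ.+ + 1 ℤ.≤? z) ×-dec (z ℤ.≤? S ℤ.+ + T)

  private
    residues window : List ℤ
    residues = map (+_ ∘ toℕ) (allFin p)
    window   = map (λ k → S ℤ.+ + suc k) (upTo T)

    box : List (ℤ × ℤ × ℤ)
    box = cartesianProduct residues (cartesianProduct residues window)

  solutions : List (ℤ × ℤ × ℤ)
  solutions = filter isSolution? box

  J₂ : ℕ
  J₂ = length solutions

  -- `solutions` lists every integer solution exactly once, although the
  -- search is restricted to a finite box.

  private
    residue : ∀ {x} {W : Subset p} → x ∈ℤ W → x List.∈ residues
    residue (i , _ , refl) = ∈-map⁺ (+_ ∘ toℕ) (∈-allFin i)

    cancel : ∀ s t → ℤ.- s ℤ.+ (s ℤ.+ t) ≡ t
    cancel = solve 2 (λ s t → :- s :+ (s :+ t) := t) refl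
      where open ℤ-Solver

    in-window : ∀ {z} → S ℤ.+ + 1 ℤ.≤ z → z ℤ.≤ S ℤ.+ + T → z List.∈ window
    in-window {z} lo hi = subst (List._∈ window) (sym z≡) (∈-map⁺ _ (∈-upTo⁺ k<T))
      where
      k = ℤ.∣ z ℤ.- (S ℤ.+ + 1) ∣
      open ℤ-Solver
      back : ∀ z s → z ≡ s ℤ.+ (+ 1 ℤ.+ (z ℤ.- (s ℤ.+ + 1)))
      back = solve 2 (λ z s → z := s :+ (con (+ 1) :+ (z :- (s :+ con (+ 1))))) refl
      z≡ : z ≡ S ℤ.+ + suc k
      z≡ = trans (back z S)
        (cong (λ d → S ℤ.+ (+ 1 ℤ.+ d)) (sym (ℤP.0≤i⇒+∣i∣≡i (ℤP.i≤j⇒0≤j-i lo))))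
      k<T : k ℕ.< T
      k<T = ℤP.drop‿+≤+ (subst₂ ℤ._≤_ (cancel S (+ suc k)) (cancel S (+ T))
        (ℤP.+-monoʳ-≤ (ℤ.- S) (subst (ℤ._≤ S ℤ.+ + T) z≡ hi)))

    residues-unique : Unique residues
    residues-unique = Unique.map⁺ (toℕ-injective ∘ ℤP.+-injective) (Unique.allFin⁺ p)

    window-unique : Unique window
    window-unique = Unique.map⁺
      (λ {i} {j} e → ℕP.suc-injective (ℤP.+-injective
        (subst₂ _≡_ (cancel S (+ suc i)) (cancel S (+ suc j)) (cong (ℤ._+_ (ℤ.- S)) e))))
      (Unique.upTo⁺ T)

  ∈-solutions : ∀ t → t List.∈ solutions ⇔ IsSolution t
  ∈-solutions t = mk⇔ (proj₂ ∘ ∈-filter⁻ isSolution? {xs = box}) complete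
    where
    complete : IsSolution t → t List.∈ solutions
    complete s@(_ , x∈U , y∈V , lo , hi) = ∈-filter⁺ isSolution?
      (∈-cartesianProduct⁺ (residue x∈U) (∈-cartesianProduct⁺ (residue y∈V) (in-window lo hi))) s

  solutions-unique : Unique solutions
  solutions-unique = Unique.filter⁺ isSolution?
    (Unique.cartesianProduct⁺ residues-unique
      (Unique.cartesianProduct⁺ residues-unique window-unique))

{-# OPTIONS --safe #-}

-- Smooth the interval by a convolution with an interval of length h ≤ T:
-- h J₂ lies between the numbers of solutions of x y ≡ c + b with 0 ≤ b < h and
-- c in an interval of length T - h, respectively T + h.  Such solutions are
-- incidences of the v h points (y , b) with lines of slope x and intercept - c.
-- Over all p² lines the number of incidences has mean v h / p and variance at
-- most v h / p, because two points share at most one line, so by Cauchy–Schwarz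
--   |J₂ - u v T / p| ≪ u v h / p + √(p u v T / h),
-- and h is chosen to balance the two terms, subject to h ≤ T.  The outer
-- interval has at most 2 p terms, hence meets each residue at most twice.

module Submission where

-- Why smooth at all: with h = 1 the variance alone gives √(p u v T), too large by √T. The second
-- coordinate b supplies h times as many points, which gains √h in the variance term and costs u v h
-- / p at the two ends of the interval.
--
-- Roots and fractions are kept out of the argument. Everything is multiplied by p, so that the mean
-- v h / p becomes the integer v h, and the deviation is controlled only through its square.
--
-- The real inequality is proved term by term. The n-th term of `root k a` is c / m with m = n + 1
-- and c = `iroot k (a * m ^ k)`, so after clearing p and m it is an inequality between integers,
-- and h is chosen afresh for each m. The balancing of h needs upper bounds for the roots, whereas c
-- / m is a lower approximation. Hence c + 1 is used, and c + 1 ≤ 2 c since c ≥ 1 when a > 0. This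
-- is why u v = 0 is treated apart.
--
-- The constant 8 is 4 from the balancing times 2 from this rounding.

open import Defs

-- Finite sums of integers over lists, and indicator functions.

module FiniteSums where

  open import Data.Integer using (ℤ; +_; -[1+_]; ∣_∣; 0ℤ; 1ℤ; _+_; _-_; _*_; -_; _≤_; +≤+; nonNegative)
  open import Data.Integer.Properties
  open import Data.Integer.Tactic.RingSolver using (solve-∀)
  open import Data.List using (List; []; _∷_; _++_; map; length; filter; cartesianProduct; applyUpTo; upTo)
  open import Data.List.Membership.Propositional using (_∈_)
  open import Data.List.Properties using (map-upTo)
  open import Data.List.Relation.Unary.All as All using ([]; _∷_)
  open import Data.List.Relation.Unary.Any using (here; there)
  open import Data.List.Relation.Unary.AllPairs using ([]; _∷_)
  open import Data.List.Relation.Unary.Unique.Propositional using (Unique)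
  open import Data.Nat as ℕ using (ℕ; zero; suc; z≤n)
  import Data.Nat.Properties as ℕP
  open import Data.Product using (_×_; _,_; proj₁; proj₂)
  open import Function using (_∘_; id; _⇔_; Equivalence)
  open import Relation.Binary.PropositionalEquality
  open import Relation.Nullary using (Dec; yes; no; contradiction)
  open import Relation.Unary using (Decidable)

  private variable
    A B : Set

  *-nonneg : ∀ {i j} → 0ℤ ≤ i → 0ℤ ≤ j → 0ℤ ≤ i * j
  *-nonneg {+ m} {+ n} _ _ = subst (0ℤ ≤_) (pos-* m n) (+≤+ z≤n)

  square-nonneg : ∀ i → 0ℤ ≤ i * i
  square-nonneg i = subst (0ℤ ≤_) (∣i∣²≡i² i) (+≤+ z≤n)
    where
    ∣i∣²≡i² : ∀ i → + (∣ i ∣ ℕ.* ∣ i ∣) ≡ i * i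
    ∣i∣²≡i² (+ n) = pos-* n n
    ∣i∣²≡i² -[1+ n ] = refl

  *-monoˡ-≤ : ∀ {i j k} → 0ℤ ≤ k → i ≤ j → k * i ≤ k * j
  *-monoˡ-≤ {k = k} 0≤k = *-monoˡ-≤-nonNeg k {{nonNegative 0≤k}}

  ∑ : List A → (A → ℤ) → ℤ
  ∑ []       f = 0ℤ
  ∑ (x ∷ xs) f = f x + ∑ xs f

  infix 5 ∑
  syntax ∑ xs (λ x → e) = ∑[ x ∈ xs ] e

  ∑-cong-∈ : ∀ (xs : List A) {f g} → (∀ {x} → x ∈ xs → f x ≡ g x) → ∑ xs f ≡ ∑ xs g
  ∑-cong-∈ []       f≡g = refl
  ∑-cong-∈ (x ∷ xs) f≡g = cong₂ _+_ (f≡g (here refl)) (∑-cong-∈ xs (f≡g ∘ there))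

  ∑-cong : ∀ (xs : List A) {f g} → (∀ x → f x ≡ g x) → ∑ xs f ≡ ∑ xs g
  ∑-cong xs f≡g = ∑-cong-∈ xs λ {x} _ → f≡g x

  ∑-mono-∈ : ∀ (xs : List A) {f g} → (∀ {x} → x ∈ xs → f x ≤ g x) → ∑ xs f ≤ ∑ xs g
  ∑-mono-∈ []       f≤g = ≤-refl
  ∑-mono-∈ (x ∷ xs) f≤g = +-mono-≤ (f≤g (here refl)) (∑-mono-∈ xs (f≤g ∘ there))

  ∑-mono : ∀ (xs : List A) {f g} → (∀ x → f x ≤ g x) → ∑ xs f ≤ ∑ xs g
  ∑-mono xs f≤g = ∑-mono-∈ xs λ {x} _ → f≤g x

  ∑-const : ∀ (xs : List A) c → (∑[ _ ∈ xs ] c) ≡ + length xs * c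
  ∑-const []       c = sym (*-zeroˡ c)
  ∑-const (x ∷ xs) c = trans (cong (_+_ c) (∑-const xs c)) (lemma c (+ length xs))
    where
    lemma : ∀ c n → c + n * c ≡ (1ℤ + n) * c
    lemma = solve-∀

  ∑-nonneg : ∀ (xs : List A) {f} → (∀ x → 0ℤ ≤ f x) → 0ℤ ≤ ∑ xs f
  ∑-nonneg xs 0≤f = subst (_≤ ∑ xs _) (trans (∑-const xs 0ℤ) (*-zeroʳ (+ length xs))) (∑-mono xs 0≤f)

  ∑-distrib-+ : ∀ (xs : List A) f g → (∑[ x ∈ xs ] (f x + g x)) ≡ ∑ xs f + ∑ xs g
  ∑-distrib-+ []       f g = refl
  ∑-distrib-+ (x ∷ xs) f g =
    trans (cong (_+_ (f x + g x)) (∑-distrib-+ xs f g)) (lemma (f x) (g x) (∑ xs f) (∑ xs g))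
    where
    lemma : ∀ a b c d → a + b + (c + d) ≡ a + c + (b + d)
    lemma = solve-∀

  *-distribˡ-∑ : ∀ (xs : List A) c f → c * ∑ xs f ≡ (∑[ x ∈ xs ] c * f x)
  *-distribˡ-∑ []       c f = *-zeroʳ c
  *-distribˡ-∑ (x ∷ xs) c f =
    trans (*-distribˡ-+ c (f x) (∑ xs f)) (cong (_+_ (c * f x)) (*-distribˡ-∑ xs c f))

  ∑-swap : ∀ (xs : List A) (ys : List B) (f : A → B → ℤ) →
           (∑[ x ∈ xs ] ∑[ y ∈ ys ] f x y) ≡ (∑[ y ∈ ys ] ∑[ x ∈ xs ] f x y)
  ∑-swap []       ys f = sym (trans (∑-const ys 0ℤ) (*-zeroʳ (+ length ys)))
  ∑-swap (x ∷ xs) ys f = trans (cong (_+_ (∑ ys (f x))) (∑-swap xs ys f))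
    (sym (∑-distrib-+ ys (f x) λ y → ∑[ x ∈ xs ] f x y))

  ∑-++ : ∀ (xs ys : List A) f → ∑ (xs ++ ys) f ≡ ∑ xs f + ∑ ys f
  ∑-++ []       ys f = sym (+-identityˡ (∑ ys f))
  ∑-++ (x ∷ xs) ys f = trans (cong (_+_ (f x)) (∑-++ xs ys f)) (sym (+-assoc (f x) (∑ xs f) (∑ ys f)))

  ∑-map : ∀ (g : A → B) xs f → ∑ (map g xs) f ≡ ∑ xs (f ∘ g)
  ∑-map g []       f = refl
  ∑-map g (x ∷ xs) f = cong (_+_ (f (g x))) (∑-map g xs f)

  ∑-cartesianProduct : ∀ (xs : List A) (ys : List B) f →
    ∑ (cartesianProduct xs ys) f ≡ (∑[ x ∈ xs ] ∑[ y ∈ ys ] f (x , y))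
  ∑-cartesianProduct []       ys f = refl
  ∑-cartesianProduct (x ∷ xs) ys f = trans
    (∑-++ (map (x ,_) ys) (cartesianProduct xs ys) f)
    (cong₂ _+_ (∑-map (x ,_) ys f) (∑-cartesianProduct xs ys f))

  ∑-*-∑ : ∀ (xs : List A) (ys : List B) f g →
    ∑ xs f * ∑ ys g ≡ (∑[ x ∈ xs ] ∑[ y ∈ ys ] f x * g y)
  ∑-*-∑ xs ys f g = begin
    ∑ xs f * ∑ ys g                    ≡⟨ *-comm (∑ xs f) (∑ ys g) ⟩
    ∑ ys g * ∑ xs f                    ≡⟨ *-distribˡ-∑ xs (∑ ys g) f ⟩
    (∑[ x ∈ xs ] ∑ ys g * f x)         ≡⟨ ∑-cong xs (λ x → trans (*-comm (∑ ys g) (f x)) (*-distribˡ-∑ ys (f x) g)) ⟩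
    (∑[ x ∈ xs ] ∑[ y ∈ ys ] f x * g y) ∎
    where open ≡-Reasoning

  ∑-upTo-+ : ∀ m n f → ∑ (upTo (m ℕ.+ n)) f ≡ ∑ (upTo m) f + (∑[ k ∈ upTo n ] f (m ℕ.+ k))
  ∑-upTo-+ m n f = begin
    ∑ (upTo (m ℕ.+ n)) f                             ≡⟨ cong (λ xs → ∑ xs f) (applyUpTo-+ id m) ⟩
    ∑ (upTo m ++ applyUpTo (m ℕ.+_) n) f             ≡⟨ ∑-++ (upTo m) _ f ⟩
    ∑ (upTo m) f + ∑ (applyUpTo (m ℕ.+_) n) f        ≡⟨ cong (λ xs → ∑ (upTo m) f + ∑ xs f) (sym (map-upTo (m ℕ.+_) n)) ⟩
    ∑ (upTo m) f + ∑ (map (m ℕ.+_) (upTo n)) f       ≡⟨ cong (_+_ (∑ (upTo m) f)) (∑-map (m ℕ.+_) (upTo n) f) ⟩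
    ∑ (upTo m) f + (∑[ k ∈ upTo n ] f (m ℕ.+ k))     ∎
    where
    open ≡-Reasoning
    applyUpTo-+ : ∀ (g : ℕ → A) m → applyUpTo g (m ℕ.+ n) ≡ applyUpTo g m ++ applyUpTo (g ∘ (m ℕ.+_)) n
    applyUpTo-+ g zero    = refl
    applyUpTo-+ g (suc m) = cong (g 0 ∷_) (applyUpTo-+ (g ∘ suc) m)

  -- Enlarging an interval of summation at both ends; it serves both the comparison with longer and
  -- shorter intervals and the extension to two full periods.
  ∑-upTo-shift-≤ : ∀ s n {m} f → (∀ k → 0ℤ ≤ f k) → s ℕ.+ n ℕ.≤ m →
    (∑[ k ∈ upTo n ] f (s ℕ.+ k)) ≤ ∑ (upTo m) f
  ∑-upTo-shift-≤ s n {m} f 0≤f s+n≤m = begin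
    F                                     ≡⟨ lemma F ⟩
    0ℤ + F + 0ℤ                           ≤⟨ +-mono-≤ (+-monoˡ-≤ F (∑-nonneg (upTo s) 0≤f)) (∑-nonneg (upTo r) (λ k → 0≤f (s ℕ.+ n ℕ.+ k))) ⟩
    ∑ (upTo s) f + F + (∑[ k ∈ upTo r ] f (s ℕ.+ n ℕ.+ k)) ≡⟨ cong (λ t → t + (∑[ k ∈ upTo r ] f (s ℕ.+ n ℕ.+ k))) (∑-upTo-+ s n f) ⟨
    ∑ (upTo (s ℕ.+ n)) f + (∑[ k ∈ upTo r ] f (s ℕ.+ n ℕ.+ k)) ≡⟨ ∑-upTo-+ (s ℕ.+ n) r f ⟨
    ∑ (upTo (s ℕ.+ n ℕ.+ r)) f            ≡⟨ cong (λ t → ∑ (upTo t) f) (ℕP.m+[n∸m]≡n s+n≤m) ⟩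
    ∑ (upTo m) f                          ∎
    where
    open ≤-Reasoning
    r = m ℕ.∸ (s ℕ.+ n)
    F = ∑[ k ∈ upTo n ] f (s ℕ.+ k)
    lemma : ∀ x → x ≡ 0ℤ + x + 0ℤ
    lemma = solve-∀

  -- Prepending an entry with value t increases the gap between the two sides by n t² + q - 2 t s,
  -- where n, s, q are the length, sum and sum of squares of the tail. This is the sum of (f y -
  -- t)², so it is nonnegative (`am-gm`).
  cauchy-schwarz : ∀ (xs : List A) f → ∑ xs f * ∑ xs f ≤ + length xs * (∑[ x ∈ xs ] f x * f x)
  cauchy-schwarz []       f = ≤-refl
  cauchy-schwarz (x ∷ xs) f = 0≤i-j⇒j≤i (subst (0ℤ ≤_) (lemma (f x) (∑ xs f) (∑[ x ∈ xs ] f x * f x) (+ length xs))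
    (+-mono-≤ (i≤j⇒0≤j-i (am-gm (f x) xs)) (i≤j⇒0≤j-i (cauchy-schwarz xs f))))
    where
    lemma : ∀ t s q n → n * (t * t) + q - + 2 * t * s + (n * q - s * s)
      ≡ (1ℤ + n) * (t * t + q) - (t + s) * (t + s)
    lemma = solve-∀
    step : ∀ t y n s q → (y - t) * (y - t) + (n * (t * t) + q - + 2 * t * s)
      ≡ (1ℤ + n) * (t * t) + (y * y + q) - + 2 * t * (y + s)
    step = solve-∀
    zero-case : ∀ t → + 2 * t * 0ℤ ≡ 0ℤ * (t * t) + 0ℤ
    zero-case = solve-∀
    am-gm : ∀ t ys → + 2 * t * ∑ ys f ≤ + length ys * (t * t) + (∑[ y ∈ ys ] f y * f y)
    am-gm t []       = ≤-reflexive (zero-case t)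
    am-gm t (y ∷ ys) = 0≤i-j⇒j≤i (subst (0ℤ ≤_)
      (step t (f y) (+ length ys) (∑ ys f) (∑[ y ∈ ys ] f y * f y))
      (+-mono-≤ (square-nonneg (f y - t)) (i≤j⇒0≤j-i (am-gm t ys))))

  𝟙 : ∀ {P : Set} → Dec P → ℤ
  𝟙 (yes _) = 1ℤ
  𝟙 (no  _) = 0ℤ

  𝟙-nonneg : ∀ {P : Set} (P? : Dec P) → 0ℤ ≤ 𝟙 P?
  𝟙-nonneg (yes _) = +≤+ z≤n
  𝟙-nonneg (no  _) = ≤-refl

  𝟙-cong : ∀ {P Q : Set} (P? : Dec P) (Q? : Dec Q) → P ⇔ Q → 𝟙 P? ≡ 𝟙 Q?
  𝟙-cong (yes _) (yes _) _   = refl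
  𝟙-cong (yes p) (no ¬q) P⇔Q = contradiction (Equivalence.to P⇔Q p) ¬q
  𝟙-cong (no ¬p) (yes q) P⇔Q = contradiction (Equivalence.from P⇔Q q) ¬p
  𝟙-cong (no _)  (no _)  _   = refl

  𝟙-× : ∀ {P Q R : Set} (P? : Dec P) (Q? : Dec Q) (R? : Dec R) → R ⇔ (P × Q) → 𝟙 R? ≡ 𝟙 P? * 𝟙 Q?
  𝟙-× (yes p) (yes q) R? R⇔ = 𝟙-cong R? (yes (p , q)) R⇔
  𝟙-× (no ¬p) Q? R? R⇔ = trans (𝟙-cong R? (no (¬p ∘ proj₁)) R⇔) (sym (*-zeroˡ (𝟙 Q?)))
  𝟙-× (yes p) (no ¬q) R? R⇔ = 𝟙-cong R? (no (¬q ∘ proj₂)) R⇔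

  module _ {P : A → Set} (P? : Decidable P) where

    ∑-filter : ∀ xs f → ∑ (filter P? xs) f ≡ (∑[ x ∈ xs ] 𝟙 (P? x) * f x)
    ∑-filter []       f = refl
    ∑-filter (x ∷ xs) f with P? x
    ... | yes _ = cong₂ _+_ (sym (*-identityˡ (f x))) (∑-filter xs f)
    ... | no  _ = trans (∑-filter xs f) (trans (sym (+-identityˡ _)) (cong (λ t → t + (∑[ x ∈ xs ] 𝟙 (P? x) * f x)) (sym (*-zeroˡ (f x)))))

    ∑-filter-≤ : ∀ xs {f} → (∀ x → 0ℤ ≤ f x) → ∑ (filter P? xs) f ≤ ∑ xs f
    ∑-filter-≤ []       0≤f = ≤-refl
    ∑-filter-≤ (x ∷ xs) {f} 0≤f with P? x
    ... | yes _ = +-monoʳ-≤ (f x) (∑-filter-≤ xs 0≤f)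
    ... | no  _ = subst (_≤ f x + ∑ xs f) (+-identityˡ _) (+-mono-≤ (0≤f x) (∑-filter-≤ xs 0≤f))

    length-filter-∑ : ∀ xs → + length (filter P? xs) ≡ (∑[ x ∈ xs ] 𝟙 (P? x))
    length-filter-∑ []       = refl
    length-filter-∑ (x ∷ xs) with P? x
    ... | yes _ = cong (_+_ 1ℤ) (length-filter-∑ xs)
    ... | no  _ = trans (length-filter-∑ xs) (sym (+-identityˡ _))

    ∑𝟙≤1 : ∀ xs → Unique xs → (∀ {x y} → x ∈ xs → y ∈ xs → P x → P y → x ≡ y) →
           (∑[ x ∈ xs ] 𝟙 (P? x)) ≤ 1ℤ
    ∑𝟙≤1 []       _            _    = +≤+ z≤n
    ∑𝟙≤1 (x ∷ xs) (x∉xs ∷ xs!) uniq with P? x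
    ... | no  _  = subst (_≤ 1ℤ) (sym (+-identityˡ _)) (∑𝟙≤1 xs xs! λ i j → uniq (there i) (there j))
    ... | yes px = +-monoʳ-≤ 1ℤ (≤-trans (∑-mono-∈ xs vanish) (≤-reflexive (trans (∑-const xs 0ℤ) (*-zeroʳ (+ length xs)))))
      where
      vanish : ∀ {y} → y ∈ xs → 𝟙 (P? y) ≤ 0ℤ
      vanish {y} y∈xs with P? y
      ... | no  _  = ≤-refl
      ... | yes py = contradiction (uniq (here refl) (there y∈xs) px py) (All.lookup x∉xs y∈xs)

    1≤∑𝟙 : ∀ {x} xs → x ∈ xs → P x → 1ℤ ≤ (∑[ x ∈ xs ] 𝟙 (P? x))
    1≤∑𝟙 {x} (_ ∷ xs) (here refl) px with P? x
    ... | yes _  = +-monoʳ-≤ 1ℤ (∑-nonneg xs (𝟙-nonneg ∘ P?))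
    ... | no ¬px = contradiction px ¬px
    1≤∑𝟙 (y ∷ xs) (there x∈xs) px = +-mono-≤ (𝟙-nonneg (P? y)) (1≤∑𝟙 xs x∈xs px)

-- Point-line incidences modulo p: moments, deviation and smoothing.

module Incidences where

  open FiniteSums
  open import Data.Fin as Fin using (Fin; toℕ)
  open import Data.Fin.Properties using (toℕ<n; toℕ-injective)
  open import Data.Integer using (ℤ; +_; 0ℤ; 1ℤ; _+_; _-_; _*_; -_; _≤_; +≤+; ∣_∣; nonNegative)
  open import Data.Integer.Divisibility.Signed using (_∣_; _∣?_; divides; ∣⇒∣ᵤ; ∣ᵤ⇒∣; ∣m∣n⇒∣m-n)
  open import Data.Integer.DivMod using (_%ℕ_; _/ℕ_; n%ℕd<d; a≡a%ℕn+[a/ℕn]*n)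
  open import Data.Integer.Properties
  open import Data.Integer.Tactic.RingSolver using (solve-∀)
  open import Data.List using (List; []; _∷_; length; filter; cartesianProduct; allFin; upTo)
  open import Data.List.Membership.Propositional using (_∈_)
  open import Data.List.Membership.Propositional.Properties using (∈-upTo⁺; ∈-upTo⁻)
  open import Data.List.Properties using (length-upTo; length-tabulate)
  open import Data.List.Relation.Unary.Unique.Propositional using (Unique)
  open import Data.List.Relation.Unary.Unique.Propositional.Properties using (allFin⁺; upTo⁺)
  open import Data.Nat as ℕ using (ℕ; zero; suc; z≤n)
  import Data.Nat.Divisibility as ℕ
  open import Data.Nat.Primality using (Prime; prime⇒nonZero; euclidsLemma)
  import Data.Nat.Properties as ℕP
  open import Data.Product using (∃-syntax; _×_; _,_; proj₁)
  open import Data.Sum using (inj₁; inj₂)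
  open import Function using (_∘_; id; mk⇔)
  open import Relation.Binary.PropositionalEquality
  open import Relation.Nullary using (yes; no; contradiction)
  open import Relation.Unary using (Decidable)

  length-cartesianProduct : ∀ {A B : Set} (xs : List A) (ys : List B) →
    + length (cartesianProduct xs ys) ≡ + length xs * + length ys
  length-cartesianProduct xs ys = begin
    + length (cartesianProduct xs ys)     ≡⟨ *-identityʳ _ ⟨
    + length (cartesianProduct xs ys) * 1ℤ ≡⟨ ∑-const (cartesianProduct xs ys) 1ℤ ⟨
    ∑ (cartesianProduct xs ys) (λ _ → 1ℤ) ≡⟨ ∑-cartesianProduct xs ys _ ⟩
    ∑ xs (λ _ → ∑ ys (λ _ → 1ℤ))          ≡⟨ ∑-const xs _ ⟩
    + length xs * ∑ ys (λ _ → 1ℤ)         ≡⟨ cong (_*_ (+ length xs)) (trans (∑-const ys 1ℤ) (*-identityʳ _)) ⟩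
    + length xs * + length ys             ∎
    where open ≡-Reasoning

  -- The factor c clears the denominator of the mean: the deviation from w / c is measured as c f -
  -- w.
  ∑-square-deviation : ∀ {A : Set} (ls : List A) c w f →
    (∑[ l ∈ ls ] (c * f l - w) * (c * f l - w)) ≡
    c * c * (∑[ l ∈ ls ] f l * f l) - + 2 * c * w * ∑ ls f + + length ls * (w * w)
  ∑-square-deviation []       c w f = lemma c w
    where
    lemma : ∀ c w → 0ℤ ≡ c * c * 0ℤ - + 2 * c * w * 0ℤ + 0ℤ * (w * w)
    lemma = solve-∀
  ∑-square-deviation (l ∷ ls) c w f = trans
    (cong (_+_ ((c * f l - w) * (c * f l - w))) (∑-square-deviation ls c w f))
    (lemma c w (f l) (∑[ l ∈ ls ] f l * f l) (∑ ls f) (+ length ls))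
    where
    lemma : ∀ c w x q s n →
      (c * x - w) * (c * x - w) + (c * c * q - + 2 * c * w * s + n * (w * w)) ≡
      c * c * (x * x + q) - + 2 * c * w * (x + s) + (1ℤ + n) * (w * w)
    lemma = solve-∀

  module Modulo (p : ℕ) (p-prime : Prime p) where

    private instance
      p≢0 = prime⇒nonZero p-prime

    δ : ℤ → ℤ
    δ n = 𝟙 (+ p ∣? n)

    δ-nonneg : ∀ n → 0ℤ ≤ δ n
    δ-nonneg n = 𝟙-nonneg (+ p ∣? n)

    ∣-difference : ∀ {i j k} → i - j ≡ k → + p ∣ i → + p ∣ j → + p ∣ k
    ∣-difference i-j≡k p∣i p∣j = subst (+ p ∣_) i-j≡k (∣m∣n⇒∣m-n p∣i p∣j)

    residue-unique : ∀ {i j} → i ℕ.< p → j ℕ.< p → + p ∣ + i - + j → i ≡ j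
    residue-unique {i} {j} i<p j<p p∣i-j = +-injective (i-j≡0⇒i≡j (+ i) (+ j) (∣i∣≡0⇒i≡0 (∣d∣≡0 ∣ + i - + j ∣ refl)))
      where
      bound : ∣ + i - + j ∣ ℕ.< p
      bound = ℕP.≤-<-trans (subst (λ z → ∣ z ∣ ℕ.≤ i ℕ.⊔ j) (sym (m-n≡m⊖n i j)) (∣m⊝n∣≤m⊔n i j)) (ℕP.⊔-lub i<p j<p)
      ∣d∣≡0 : ∀ d → ∣ + i - + j ∣ ≡ d → ∣ + i - + j ∣ ≡ 0
      ∣d∣≡0 zero e = e
      ∣d∣≡0 (suc d) e = contradiction (subst (p ℕ.∣_) e (∣⇒∣ᵤ p∣i-j)) (ℕ.>⇒∤ (subst (ℕ._< p) e bound))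

    val : Fin p → ℤ
    val x = + toℕ x

    val-unique : ∀ {x y} → + p ∣ val x - val y → x ≡ y
    val-unique {x} {y} = toℕ-injective ∘ residue-unique (toℕ<n x) (toℕ<n y)

    -- Fewer than p separates any two of h ≤ p consecutive integers, so at most one of them lies in
    -- the class of k.
    ∑δ≤1 : ∀ k h → h ℕ.≤ p → (∑[ i ∈ upTo h ] δ (k - + i)) ≤ 1ℤ
    ∑δ≤1 k h h≤p = ∑𝟙≤1 (λ i → + p ∣? k - + i) (upTo h) (upTo⁺ h) λ {i} {j} i∈ j∈ p∣k-i p∣k-j →
      residue-unique (ℕP.<-≤-trans (∈-upTo⁻ i∈) h≤p) (ℕP.<-≤-trans (∈-upTo⁻ j∈) h≤p)
        (∣-difference (lemma k (+ i) (+ j)) p∣k-j p∣k-i)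
      where
      lemma : ∀ k i j → (k - j) - (k - i) ≡ i - j
      lemma = solve-∀

    ∑δ≡1 : ∀ k → (∑[ i ∈ upTo p ] δ (k - + i)) ≡ 1ℤ
    ∑δ≡1 k = ≤-antisym (∑δ≤1 k p ℕP.≤-refl)
      (1≤∑𝟙 (λ i → + p ∣? k - + i) (upTo p) (∈-upTo⁺ (n%ℕd<d k p)) (divides (k /ℕ p) quotient))
      where
      lemma : ∀ r q → r + q - r ≡ q
      lemma = solve-∀
      quotient : k - + (k %ℕ p) ≡ (k /ℕ p) * + p
      quotient = trans (cong (λ t → t - + (k %ℕ p)) (a≡a%ℕn+[a/ℕn]*n k p)) (lemma (+ (k %ℕ p)) ((k /ℕ p) * + p))

    -- A common divisor of i and j divides j - i. For two incidences with one line, j - i no longer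
    -- contains the intercept, while the retained factor δ i can be summed over all intercepts
    -- exactly.
    δ*δ≤ : ∀ i j → δ i * δ j ≤ δ i * δ (j - i)
    δ*δ≤ i j with + p ∣? i | + p ∣? j
    ... | no _    | j?      = ≤-reflexive (trans (*-zeroˡ (𝟙 j?)) (sym (*-zeroˡ (δ (j - i)))))
    ... | yes _   | no _    = subst (0ℤ ≤_) (sym (*-identityˡ (δ (j - i)))) (δ-nonneg (j - i))
    ... | yes p∣i | yes p∣j = ≤-reflexive (cong (_*_ 1ℤ) (𝟙-cong (yes (∣m∣n⇒∣m-n p∣j p∣i)) (+ p ∣? j - i) (mk⇔ id id)))

    residues : List (Fin p)
    residues = allFin p

    length-residues : + length residues ≡ + p
    length-residues = cong +_ (length-tabulate id)

    module Points (ys : List (Fin p)) (ys! : Unique ys) (h : ℕ) (h≤p : h ℕ.≤ p) where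

      points : List (Fin p × ℕ)
      points = cartesianProduct ys (upTo h)

      w : ℤ
      w = + length ys * + h

      length-points : + length points ≡ w
      length-points = trans (length-cartesianProduct ys (upTo h)) (cong (λ n → + length ys * + n) (length-upTo h))

      inc : Fin p → ℤ → Fin p × ℕ → ℤ
      inc x c (y , b) = δ (val x * val y - (c + + b))

      hits : Fin p → ℤ → ℤ
      hits x c = ∑ points (inc x c)

      -- The p² lines, with intercepts represented by p consecutive integers. The start s is left
      -- free because an interval of up to 2 p terms is covered by the windows at s and s + p.
      module Window (s : ℤ) where

        lines : List (Fin p × ℕ)
        lines = cartesianProduct residues (upTo p)

        on : Fin p × ℕ → Fin p × ℕ → ℤ
        on (x , i) = inc x (s + + i)

        ∑-on : ∀ x q → (∑[ i ∈ upTo p ] on (x , i) q) ≡ 1ℤ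
        ∑-on x (y , b) = trans (∑-cong (upTo p) λ i → cong δ (lemma (val x * val y) s (+ i) (+ b)))
                               (∑δ≡1 (val x * val y - (s + + b)))
          where
          lemma : ∀ k s i b → k - (s + i + b) ≡ k - (s + b) - i
          lemma = solve-∀

        -- Through each of the w points passes exactly one line of each of the p slopes.
        first-moment : (∑[ l ∈ lines ] ∑ points (on l)) ≡ + p * w
        first-moment = begin
          (∑[ l ∈ lines ] ∑ points (on l))                                 ≡⟨ ∑-swap lines points on ⟩
          (∑[ q ∈ points ] ∑[ l ∈ lines ] on l q)                          ≡⟨ ∑-cong points (λ q → ∑-cartesianProduct residues (upTo p) (λ l → on l q)) ⟩
          (∑[ q ∈ points ] ∑[ x ∈ residues ] ∑[ i ∈ upTo p ] on (x , i) q) ≡⟨ ∑-cong points (λ q → ∑-cong residues (λ x → ∑-on x q)) ⟩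
          (∑[ q ∈ points ] ∑[ x ∈ residues ] 1ℤ)                           ≡⟨ ∑-cong points (λ q → trans (∑-const residues 1ℤ) (trans (*-identityʳ _) length-residues)) ⟩
          (∑[ q ∈ points ] + p)                                            ≡⟨ ∑-const points (+ p) ⟩
          + length points * + p                                            ≡⟨ cong (λ n → n * + p) length-points ⟩
          w * + p                                                          ≡⟨ *-comm w (+ p) ⟩
          + p * w                                                          ∎
          where open ≡-Reasoning

        -- Tells whether the line of slope x through the first point passes through the second: the
        -- difference of the two incidence conditions, with the intercept eliminated.
        agreement : Fin p × ℕ → Fin p × ℕ → Fin p → ℤ
        agreement (y , b) (y′ , b′) x = δ (val x * (val y′ - val y) + + b - + b′)

        ∑-on*on : ∀ q q′ → (∑[ l ∈ lines ] on l q * on l q′) ≤ ∑ residues (agreement q q′)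
        ∑-on*on q@(y , b) q′@(y′ , b′) = begin
          (∑[ l ∈ lines ] on l q * on l q′)                                  ≡⟨ ∑-cartesianProduct residues (upTo p) _ ⟩
          (∑[ x ∈ residues ] ∑[ i ∈ upTo p ] on (x , i) q * on (x , i) q′)   ≤⟨ ∑-mono residues (λ x → ∑-mono (upTo p) (λ i → pair x i)) ⟩
          (∑[ x ∈ residues ] ∑[ i ∈ upTo p ] agreement q q′ x * on (x , i) q) ≡⟨ ∑-cong residues (λ x → sym (*-distribˡ-∑ (upTo p) (agreement q q′ x) _)) ⟩
          (∑[ x ∈ residues ] agreement q q′ x * (∑[ i ∈ upTo p ] on (x , i) q)) ≡⟨ ∑-cong residues (λ x → trans (cong (_*_ (agreement q q′ x)) (∑-on x q)) (*-identityʳ _)) ⟩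
          ∑ residues (agreement q q′)                                        ∎
          where
          open ≤-Reasoning
          lemma : ∀ x y y′ c b b′ → x * y′ - (c + b′) - (x * y - (c + b)) ≡ x * (y′ - y) + b - b′
          lemma = solve-∀
          pair : ∀ x i → on (x , i) q * on (x , i) q′ ≤ agreement q q′ x * on (x , i) q
          pair x i = ≤-trans (δ*δ≤ (val x * val y - (s + + i + + b)) (val x * val y′ - (s + + i + + b′)))
            (≤-reflexive (trans (cong (λ t → on (x , i) q * δ t) (lemma (val x) (val y) (val y′) (s + + i) (+ b) (+ b′)))
              (*-comm (on (x , i) q) (agreement q q′ x))))

        -- If y ≠ y′ then at most one slope joins q to each (y′ , b′); if y = y′
        -- then each slope joins q to at most one b′, as h ≤ p.
        ∑-agreement : ∀ q y′ → (∑[ b′ ∈ upTo h ] ∑ residues (agreement q (y′ , b′))) ≤ + p * 𝟙 (proj₁ q Fin.≟ y′) + + h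
        ∑-agreement (y , b) y′ with y Fin.≟ y′
        ... | yes _ = begin
          (∑[ b′ ∈ upTo h ] ∑[ x ∈ residues ] δ (val x * (val y′ - val y) + + b - + b′)) ≡⟨ ∑-swap (upTo h) residues _ ⟩
          (∑[ x ∈ residues ] ∑[ b′ ∈ upTo h ] δ (val x * (val y′ - val y) + + b - + b′)) ≤⟨ ∑-mono residues (λ x → ∑δ≤1 (val x * (val y′ - val y) + + b) h h≤p) ⟩
          (∑[ x ∈ residues ] 1ℤ)                                                     ≡⟨ ∑-const residues 1ℤ ⟩
          + length residues * 1ℤ                                                     ≡⟨ cong (λ n → n * 1ℤ) length-residues ⟩
          + p * 1ℤ                                                                   ≤⟨ i≤i+j (+ p * 1ℤ) (+ h) ⟩
          + p * 1ℤ + + h                                                             ∎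
          where open ≤-Reasoning
        ... | no y≢y′ = begin
          (∑[ b′ ∈ upTo h ] ∑[ x ∈ residues ] δ (val x * (val y′ - val y) + + b - + b′)) ≤⟨ ∑-mono (upTo h) (λ b′ → ∑𝟙≤1 (λ x → + p ∣? val x * (val y′ - val y) + + b - + b′) residues (allFin⁺ p) (λ _ _ → one-slope b′)) ⟩
          (∑[ b′ ∈ upTo h ] 1ℤ)  ≡⟨ ∑-const (upTo h) 1ℤ ⟩
          + length (upTo h) * 1ℤ ≡⟨ cong (λ n → + n * 1ℤ) (length-upTo h) ⟩
          + h * 1ℤ               ≡⟨ lemma₀ (+ p) (+ h) ⟩
          + p * 0ℤ + + h         ∎
          where
          open ≤-Reasoning
          lemma₀ : ∀ p h → h * 1ℤ ≡ p * 0ℤ + h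
          lemma₀ = solve-∀
          lemma : ∀ x x′ d b b′ → x * d + b - b′ - (x′ * d + b - b′) ≡ (x - x′) * d
          lemma = solve-∀
          one-slope : ∀ b′ {x x′} → + p ∣ val x * (val y′ - val y) + + b - + b′ →
                      + p ∣ val x′ * (val y′ - val y) + + b - + b′ → x ≡ x′
          -- Subtracting the two conditions leaves p ∣ (x - x′)(y′ - y), to which Euclid's lemma
          -- applies.
          one-slope b′ {x} {x′} p∣ p∣′
            with euclidsLemma ∣ val x - val x′ ∣ ∣ val y′ - val y ∣ p-prime
                   (subst (p ℕ.∣_) (abs-* (val x - val x′) (val y′ - val y))
                     (∣⇒∣ᵤ (∣-difference (lemma (val x) (val x′) (val y′ - val y) (+ b) (+ b′)) p∣ p∣′)))
          ... | inj₁ p∣x-x′ = val-unique (∣ᵤ⇒∣ p∣x-x′)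
          ... | inj₂ p∣y′-y = contradiction (sym (val-unique (∣ᵤ⇒∣ p∣y′-y))) y≢y′

        -- Expanding the square counts lines through ordered pairs of points. For a fixed first
        -- point q, the column y′ = y contributes an extra p, and every column contributes at most h
        -- besides, in total p + w.
        second-moment : (∑[ l ∈ lines ] ∑ points (on l) * ∑ points (on l)) ≤ w * (+ p + w)
        second-moment = begin
          (∑[ l ∈ lines ] ∑ points (on l) * ∑ points (on l))
            ≡⟨ ∑-cong lines (λ l → ∑-*-∑ points points (on l) (on l)) ⟩
          (∑[ l ∈ lines ] ∑[ q ∈ points ] ∑[ q′ ∈ points ] on l q * on l q′)
            ≡⟨ ∑-swap lines points _ ⟩
          (∑[ q ∈ points ] ∑[ l ∈ lines ] ∑[ q′ ∈ points ] on l q * on l q′)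
            ≤⟨ ∑-mono points per-point ⟩
          (∑[ q ∈ points ] (+ p + w))
            ≡⟨ ∑-const points (+ p + w) ⟩
          + length points * (+ p + w)
            ≡⟨ cong (λ n → n * (+ p + w)) length-points ⟩
          w * (+ p + w) ∎
          where
          open ≤-Reasoning
          per-point : ∀ q → (∑[ l ∈ lines ] ∑[ q′ ∈ points ] on l q * on l q′) ≤ + p + w
          per-point q@(y , b) = begin
            (∑[ l ∈ lines ] ∑[ q′ ∈ points ] on l q * on l q′)                      ≡⟨ ∑-swap lines points _ ⟩
            (∑[ q′ ∈ points ] ∑[ l ∈ lines ] on l q * on l q′)                      ≤⟨ ∑-mono points (∑-on*on q) ⟩
            (∑[ q′ ∈ points ] ∑ residues (agreement q q′))                          ≡⟨ ∑-cartesianProduct ys (upTo h) _ ⟩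
            (∑[ y′ ∈ ys ] ∑[ b′ ∈ upTo h ] ∑ residues (agreement q (y′ , b′)))      ≤⟨ ∑-mono ys (∑-agreement q) ⟩
            (∑[ y′ ∈ ys ] (+ p * 𝟙 (y Fin.≟ y′) + + h))                             ≡⟨ ∑-distrib-+ ys _ _ ⟩
            (∑[ y′ ∈ ys ] + p * 𝟙 (y Fin.≟ y′)) + (∑[ y′ ∈ ys ] + h)                ≡⟨ cong₂ _+_ (sym (*-distribˡ-∑ ys (+ p) _)) (∑-const ys (+ h)) ⟩
            + p * (∑[ y′ ∈ ys ] 𝟙 (y Fin.≟ y′)) + w                                 ≤⟨ +-monoˡ-≤ w (*-monoˡ-≤ {k = + p} (+≤+ z≤n) (∑𝟙≤1 (y Fin.≟_) ys ys! (λ _ _ e e′ → trans (sym e) e′))) ⟩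
            + p * 1ℤ + w                                                            ≡⟨ cong (λ t → t + w) (*-identityʳ (+ p)) ⟩
            + p + w                                                                 ∎

        -- The w² terms cancel: p² w (p + w) - 2 p² w² + p² w² = p³ w, which after division by p²
        -- for the scaling is the variance sum p w over the p² lines.
        variance : (∑[ x ∈ residues ] ∑[ i ∈ upTo p ] (+ p * hits x (s + + i) - w) * (+ p * hits x (s + + i) - w))
                   ≤ + p * + p * + p * w
        variance = begin
          (∑[ x ∈ residues ] ∑[ i ∈ upTo p ] (+ p * hits x (s + + i) - w) * (+ p * hits x (s + + i) - w))
            ≡⟨ ∑-cartesianProduct residues (upTo p) _ ⟨
          (∑[ l ∈ lines ] (+ p * F l - w) * (+ p * F l - w))
            ≡⟨ ∑-square-deviation lines (+ p) w F ⟩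
          + p * + p * (∑[ l ∈ lines ] F l * F l) - + 2 * + p * w * ∑ lines F + + length lines * (w * w)
            ≡⟨ cong₂ (λ a b → + p * + p * (∑[ l ∈ lines ] F l * F l) - + 2 * + p * w * a + b * (w * w)) first-moment length-lines ⟩
          + p * + p * (∑[ l ∈ lines ] F l * F l) - + 2 * + p * w * (+ p * w) + + p * + p * (w * w)
            ≤⟨ +-monoˡ-≤ (+ p * + p * (w * w)) (+-monoˡ-≤ (- (+ 2 * + p * w * (+ p * w))) (*-monoˡ-≤ (*-nonneg {+ p} {+ p} (+≤+ z≤n) (+≤+ z≤n)) second-moment)) ⟩
          + p * + p * (w * (+ p + w)) - + 2 * + p * w * (+ p * w) + + p * + p * (w * w)
            ≡⟨ lemma (+ p) w ⟩
          + p * + p * + p * w ∎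
          where
          open ≤-Reasoning
          F : Fin p × ℕ → ℤ
          F l = ∑ points (on l)
          length-lines : + length lines ≡ + p * + p
          length-lines = trans (length-cartesianProduct residues (upTo p)) (cong₂ _*_ length-residues (cong +_ (length-upTo p)))
          lemma : ∀ p w → p * p * (w * (p + w)) - + 2 * p * w * (p * w) + p * p * (w * w) ≡ p * p * p * w
          lemma = solve-∀

      module _ {Q : Fin p → Set} (Q? : Decidable Q) where

        xs : List (Fin p)
        xs = filter Q? residues

        deviation : ℤ → ℕ → ℤ
        deviation s n = ∑[ x ∈ xs ] ∑[ i ∈ upTo n ] (+ p * hits x (s + + i) - w)

        deviation-≡ : ∀ s n →
          deviation s n ≡ + p * (∑[ x ∈ xs ] ∑[ i ∈ upTo n ] hits x (s + + i)) - + length xs * (+ n * w)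
        deviation-≡ s n = begin
          (∑[ x ∈ xs ] ∑[ i ∈ upTo n ] (+ p * hits x (s + + i) - w))
            ≡⟨ ∑-cong xs (λ x → split (upTo n) (λ i → hits x (s + + i)) w) ⟩
          (∑[ x ∈ xs ] (+ p * (∑[ i ∈ upTo n ] hits x (s + + i)) - + length (upTo n) * w))
            ≡⟨ split xs (λ x → ∑[ i ∈ upTo n ] hits x (s + + i)) (+ length (upTo n) * w) ⟩
          + p * (∑[ x ∈ xs ] ∑[ i ∈ upTo n ] hits x (s + + i)) - + length xs * (+ length (upTo n) * w)
            ≡⟨ cong (λ m → + p * (∑[ x ∈ xs ] ∑[ i ∈ upTo n ] hits x (s + + i)) - + length xs * (+ m * w)) (length-upTo n) ⟩
          + p * (∑[ x ∈ xs ] ∑[ i ∈ upTo n ] hits x (s + + i)) - + length xs * (+ n * w) ∎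
          where
          open ≡-Reasoning
          split : ∀ {A : Set} (zs : List A) f c → (∑[ z ∈ zs ] (+ p * f z - c)) ≡ + p * ∑ zs f - + length zs * c
          split zs f c = trans (∑-distrib-+ zs (λ z → + p * f z) (λ _ → - c))
            (cong₂ _+_ (sym (*-distribˡ-∑ zs (+ p) f))
              (trans (∑-const zs (- c)) (sym (neg-distribʳ-* (+ length zs) c))))

        -- Cauchy-Schwarz over x and then over i costs the factor |xs| n. The remaining sum of
        -- squares only grows when the slopes are enlarged to all residues and the intercepts to two
        -- windows, whence the 2.
        deviation² : ∀ s n → n ℕ.≤ p ℕ.+ p →
          deviation s n * deviation s n ≤ + length xs * (+ n * (+ 2 * (+ p * + p * + p * w)))
        deviation² s n n≤2p = begin
          deviation s n * deviation s n
            ≤⟨ cauchy-schwarz xs _ ⟩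
          + length xs * (∑[ x ∈ xs ] (∑[ i ∈ upTo n ] e x (+ i)) * (∑[ i ∈ upTo n ] e x (+ i)))
            ≤⟨ *-monoˡ-≤ {k = + length xs} (+≤+ z≤n) (∑-mono xs λ x → cauchy-schwarz (upTo n) (λ i → e x (+ i))) ⟩
          + length xs * (∑[ x ∈ xs ] + length (upTo n) * (∑[ i ∈ upTo n ] e² x (+ i)))
            ≡⟨ cong (_*_ (+ length xs)) (trans (sym (*-distribˡ-∑ xs (+ length (upTo n)) _)) (cong (λ m → + m * (∑[ x ∈ xs ] ∑[ i ∈ upTo n ] e² x (+ i))) (length-upTo n))) ⟩
          + length xs * (+ n * (∑[ x ∈ xs ] ∑[ i ∈ upTo n ] e² x (+ i)))
            ≤⟨ *-monoˡ-≤ {k = + length xs} (+≤+ z≤n) (*-monoˡ-≤ {k = + n} (+≤+ z≤n) total) ⟩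
          + length xs * (+ n * (+ 2 * (+ p * + p * + p * w))) ∎
          where
          open ≤-Reasoning
          e e² : Fin p → ℤ → ℤ
          e  x i = + p * hits x (s + i) - w
          e² x i = e x i * e x i
          reassoc : ∀ x i → e² x (+ p + + i) ≡ (+ p * hits x (s + + p + + i) - w) * (+ p * hits x (s + + p + + i) - w)
          reassoc x i = cong (λ c → (+ p * hits x c - w) * (+ p * hits x c - w)) (sym (+-assoc s (+ p) (+ i)))
          double : ∀ t → t + t ≡ + 2 * t
          double = solve-∀
          total : (∑[ x ∈ xs ] ∑[ i ∈ upTo n ] e² x (+ i)) ≤ + 2 * (+ p * + p * + p * w)
          total = begin
            (∑[ x ∈ xs ] ∑[ i ∈ upTo n ] e² x (+ i))
              ≤⟨ ∑-filter-≤ Q? residues (λ x → ∑-nonneg (upTo n) (λ i → square-nonneg (e x (+ i)))) ⟩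
            (∑[ x ∈ residues ] ∑[ i ∈ upTo n ] e² x (+ i))
              ≤⟨ ∑-mono residues (λ x → ∑-upTo-shift-≤ 0 n _ (λ i → square-nonneg (e x (+ i))) n≤2p) ⟩
            (∑[ x ∈ residues ] ∑[ i ∈ upTo (p ℕ.+ p) ] e² x (+ i))
              ≡⟨ ∑-cong residues (λ x → ∑-upTo-+ p p (λ i → e² x (+ i))) ⟩
            (∑[ x ∈ residues ] ((∑[ i ∈ upTo p ] e² x (+ i)) + (∑[ i ∈ upTo p ] e² x (+ p + + i))))
              ≡⟨ ∑-distrib-+ residues _ _ ⟩
            (∑[ x ∈ residues ] ∑[ i ∈ upTo p ] e² x (+ i)) + (∑[ x ∈ residues ] ∑[ i ∈ upTo p ] e² x (+ p + + i))
              ≡⟨ cong (_+_ (∑[ x ∈ residues ] ∑[ i ∈ upTo p ] e² x (+ i))) (∑-cong residues (λ x → ∑-cong (upTo p) (reassoc x))) ⟩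
            (∑[ x ∈ residues ] ∑[ i ∈ upTo p ] e² x (+ i)) +
            (∑[ x ∈ residues ] ∑[ i ∈ upTo p ] (+ p * hits x (s + + p + + i) - w) * (+ p * hits x (s + + p + + i) - w))
              ≤⟨ +-mono-≤ (Window.variance s) (Window.variance (s + + p)) ⟩
            + p * + p * + p * w + + p * + p * + p * w
              ≡⟨ double (+ p * + p * + p * w) ⟩
            + 2 * (+ p * + p * + p * w) ∎

        ∑-hits : ∀ c n x → (∑[ i ∈ upTo n ] hits x (c + + i)) ≡
          (∑[ y ∈ ys ] ∑[ b ∈ upTo h ] ∑[ i ∈ upTo n ] δ (val x * val y - (c + + i + + b)))
        ∑-hits c n x = trans (∑-swap (upTo n) points (λ i → inc x (c + + i))) (∑-cartesianProduct ys (upTo h) _)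

        module _ (S : ℤ) (T : ℕ) where

          near : Fin p → Fin p → ℕ → ℤ
          near x y k = δ (val x * val y - (S + + suc k))

          count : ℤ
          count = ∑[ x ∈ xs ] ∑[ y ∈ ys ] ∑[ k ∈ upTo T ] near x y k

          h*count : + h * count ≡ (∑[ x ∈ xs ] ∑[ y ∈ ys ] ∑[ b ∈ upTo h ] ∑[ k ∈ upTo T ] near x y k)
          h*count = trans (*-distribˡ-∑ xs (+ h) _) (∑-cong xs λ x →
            trans (*-distribˡ-∑ ys (+ h) _) (∑-cong ys λ y →
              sym (trans (∑-const (upTo h) _) (cong (λ n → + n * (∑[ k ∈ upTo T ] near x y k)) (length-upTo h)))))

          count-upper : + h * count ≤ (∑[ x ∈ xs ] ∑[ i ∈ upTo (T ℕ.+ h) ] hits x (S + 1ℤ - + h + + i))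
          count-upper = begin
            + h * count
              ≡⟨ h*count ⟩
            (∑[ x ∈ xs ] ∑[ y ∈ ys ] ∑[ b ∈ upTo h ] ∑[ k ∈ upTo T ] near x y k)
              ≤⟨ ∑-mono xs (λ x → ∑-mono ys λ y → ∑-mono-∈ (upTo h) λ b∈ → enlarge x y (ℕP.<⇒≤ (∈-upTo⁻ b∈))) ⟩
            (∑[ x ∈ xs ] ∑[ y ∈ ys ] ∑[ b ∈ upTo h ] ∑[ i ∈ upTo (T ℕ.+ h) ] δ (val x * val y - (S + 1ℤ - + h + + i + + b)))
              ≡⟨ ∑-cong xs (∑-hits (S + 1ℤ - + h) (T ℕ.+ h)) ⟨
            (∑[ x ∈ xs ] ∑[ i ∈ upTo (T ℕ.+ h) ] hits x (S + 1ℤ - + h + + i)) ∎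
            where
            open ≤-Reasoning
            lemma : ∀ S r k b → S + (1ℤ + k) ≡ S + 1ℤ - (r + b) + (r + k) + b
            lemma = solve-∀
            -- For fixed b, z = S + 1 + k is c + b with c = S + 1 - h + i and i = (h - b) + k < T +
            -- h.
            enlarge : ∀ x y {b} → b ℕ.≤ h → (∑[ k ∈ upTo T ] near x y k) ≤
              (∑[ i ∈ upTo (T ℕ.+ h) ] δ (val x * val y - (S + 1ℤ - + h + + i + + b)))
            enlarge x y {b} b≤h = ≤-trans
              (≤-reflexive (∑-cong (upTo T) λ k → cong (λ c → δ (val x * val y - c))
                (trans (lemma S (+ (h ℕ.∸ b)) (+ k) (+ b))
                  (cong (λ m → S + 1ℤ - + m + + (h ℕ.∸ b ℕ.+ k) + + b) (ℕP.m∸n+n≡m b≤h)))))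
              (∑-upTo-shift-≤ (h ℕ.∸ b) T (λ i → δ (val x * val y - (S + 1ℤ - + h + + i + + b))) (λ _ → δ-nonneg _)
                (ℕP.≤-trans (ℕP.+-monoˡ-≤ T (ℕP.m∸n≤m h b)) (ℕP.≤-reflexive (ℕP.+-comm h T))))

          count-lower : h ℕ.≤ T → (∑[ x ∈ xs ] ∑[ i ∈ upTo (T ℕ.∸ h) ] hits x (S + 1ℤ + + i)) ≤ + h * count
          count-lower h≤T = begin
            (∑[ x ∈ xs ] ∑[ i ∈ upTo (T ℕ.∸ h) ] hits x (S + 1ℤ + + i))
              ≡⟨ ∑-cong xs (∑-hits (S + 1ℤ) (T ℕ.∸ h)) ⟩
            (∑[ x ∈ xs ] ∑[ y ∈ ys ] ∑[ b ∈ upTo h ] ∑[ i ∈ upTo (T ℕ.∸ h) ] δ (val x * val y - (S + 1ℤ + + i + + b)))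
              ≤⟨ ∑-mono xs (λ x → ∑-mono ys λ y → ∑-mono-∈ (upTo h) λ b∈ → shrink x y (ℕP.<⇒≤ (∈-upTo⁻ b∈))) ⟩
            (∑[ x ∈ xs ] ∑[ y ∈ ys ] ∑[ b ∈ upTo h ] ∑[ k ∈ upTo T ] near x y k)
              ≡⟨ h*count ⟨
            + h * count ∎
            where
            open ≤-Reasoning
            lemma : ∀ S i b → S + 1ℤ + i + b ≡ S + (1ℤ + (b + i))
            lemma = solve-∀
            -- Here c + b = S + 1 + k with k = b + i, and k < T because i < T - h.
            shrink : ∀ x y {b} → b ℕ.≤ h →
              (∑[ i ∈ upTo (T ℕ.∸ h) ] δ (val x * val y - (S + 1ℤ + + i + + b))) ≤ (∑[ k ∈ upTo T ] near x y k)
            shrink x y {b} b≤h = ≤-trans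
              (≤-reflexive (∑-cong (upTo (T ℕ.∸ h)) λ i → cong (λ c → δ (val x * val y - c)) (lemma S (+ i) (+ b))))
              (∑-upTo-shift-≤ b (T ℕ.∸ h) (near x y) (λ _ → δ-nonneg _)
                (ℕP.≤-trans (ℕP.+-monoˡ-≤ (T ℕ.∸ h) b≤h) (ℕP.≤-reflexive (ℕP.m+[n∸m]≡n h≤T))))

          W excess : ℤ
          W = + length xs * + length ys
          excess = + p * count - W * + T

          -- W h² is the change of the scaled mean W h T when T becomes T + h or T - h. The
          -- deviation E is described by its square alone, so no root is taken, and d can be
          -- `excess` or its negative.
          SmoothedBound : ℤ → Set
          SmoothedBound d = ∃[ E ] (+ h * d ≤ W * (+ h * + h) + E) ×
                                   (E * E ≤ + 4 * (+ p * + p * + p) * (W * (+ h * + T)))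

          private
            deviation²-bound : ∀ s n → n ℕ.≤ T ℕ.+ T → T ℕ.≤ p →
              deviation s n * deviation s n ≤ + 4 * (+ p * + p * + p) * (W * (+ h * + T))
            deviation²-bound s n n≤2T T≤p = begin
              deviation s n * deviation s n                                   ≤⟨ deviation² s n (ℕP.≤-trans n≤2T (ℕP.+-mono-≤ T≤p T≤p)) ⟩
              + length xs * (+ n * (+ 2 * P))                                 ≤⟨ *-monoˡ-≤ {k = + length xs} (+≤+ z≤n) (*-monoʳ-≤-nonNeg (+ 2 * P) {{nonNegative 0≤2P}} (+≤+ n≤2T)) ⟩
              + length xs * ((+ T + + T) * (+ 2 * P))                         ≡⟨ lemma (+ length xs) (+ length ys) (+ T) (+ p) (+ h) ⟩
              + 4 * (+ p * + p * + p) * (W * (+ h * + T))                     ∎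
              where
              open ≤-Reasoning
              P = + p * + p * + p * w
              0≤+ : ∀ n → 0ℤ ≤ + n
              0≤+ n = +≤+ z≤n
              0≤2P : 0ℤ ≤ + 2 * P
              0≤2P = *-nonneg (0≤+ 2) (*-nonneg (*-nonneg (*-nonneg (0≤+ p) (0≤+ p)) (0≤+ p)) (*-nonneg (0≤+ (length ys)) (0≤+ h)))
              lemma : ∀ u v t p h → u * ((t + t) * (+ 2 * (p * p * p * (v * h)))) ≡ + 4 * (p * p * p) * (u * v * (h * t))
              lemma = solve-∀

          excess-upper : h ℕ.≤ T → T ℕ.≤ p → SmoothedBound excess
          excess-upper h≤T T≤p = deviation s n , bound , deviation²-bound s n (ℕP.+-monoʳ-≤ T h≤T) T≤p
            where
            s = S + 1ℤ - + h
            n = T ℕ.+ h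
            G = ∑[ x ∈ xs ] ∑[ i ∈ upTo n ] hits x (s + + i)
            lemma : ∀ p g u v t h → p * g - u * v * t * h ≡ u * v * (h * h) + (p * g - u * ((t + h) * (v * h)))
            lemma = solve-∀
            rescale : ∀ p h c w t → h * (p * c - w * t) ≡ p * (h * c) - w * t * h
            rescale = solve-∀
            open ≤-Reasoning
            bound : + h * excess ≤ W * (+ h * + h) + deviation s n
            bound = begin
              + h * excess                       ≡⟨ rescale (+ p) (+ h) count W (+ T) ⟩
              + p * (+ h * count) - W * + T * + h ≤⟨ +-monoˡ-≤ (- (W * + T * + h)) (*-monoˡ-≤ {k = + p} (+≤+ z≤n) count-upper) ⟩
              + p * G - W * + T * + h            ≡⟨ lemma (+ p) G (+ length xs) (+ length ys) (+ T) (+ h) ⟩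
              W * (+ h * + h) + (+ p * G - + length xs * (+ n * w)) ≡⟨ cong (_+_ (W * (+ h * + h))) (deviation-≡ s n) ⟨
              W * (+ h * + h) + deviation s n    ∎

          excess-lower : h ℕ.≤ T → T ℕ.≤ p → SmoothedBound (- excess)
          excess-lower h≤T T≤p = - deviation s n , bound ,
            subst (_≤ + 4 * (+ p * + p * + p) * (W * (+ h * + T))) (square-neg (deviation s n))
              (deviation²-bound s n (ℕP.≤-trans (ℕP.m∸n≤m T h) (ℕP.m≤m+n T T)) T≤p)
            where
            s = S + 1ℤ
            n = T ℕ.∸ h
            G = ∑[ x ∈ xs ] ∑[ i ∈ upTo n ] hits x (s + + i)
            square-neg : ∀ e → e * e ≡ - e * - e
            square-neg = solve-∀
            lemma : ∀ p g u v m h → u * v * (m + h) * h - p * g ≡ u * v * (h * h) + - (p * g - u * (m * (v * h)))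
            lemma = solve-∀
            rescale : ∀ p h c w t → h * - (p * c - w * t) ≡ w * t * h - p * (h * c)
            rescale = solve-∀
            open ≤-Reasoning
            bound : + h * - excess ≤ W * (+ h * + h) + - deviation s n
            bound = begin
              + h * - excess                       ≡⟨ rescale (+ p) (+ h) count W (+ T) ⟩
              W * + T * + h - + p * (+ h * count)  ≤⟨ +-monoʳ-≤ (W * + T * + h) (neg-mono-≤ (*-monoˡ-≤ {k = + p} (+≤+ z≤n) (count-lower h≤T))) ⟩
              W * + T * + h - + p * G              ≡⟨ cong (λ t → W * + t * + h - + p * G) (ℕP.m∸n+n≡m h≤T) ⟨
              W * (+ n + + h) * + h - + p * G      ≡⟨ lemma (+ p) G (+ length xs) (+ length ys) (+ n) (+ h) ⟩
              W * (+ h * + h) + - (+ p * G - + length xs * (+ n * w)) ≡⟨ cong (λ t → W * (+ h * + h) + - t) (deviation-≡ s n) ⟨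
              W * (+ h * + h) + - deviation s n    ∎

-- Identification of `J₂` with the count of congruences over members of U and V.

module SolutionCount where

  open FiniteSums
  open Incidences
  open import Data.Bool using (true; false)
  open import Data.Fin using (Fin; toℕ; zero; suc)
  open import Data.Fin.Properties using (toℕ-injective)
  open import Data.Fin.Subset using (Subset; _∈_; ∣_∣)
  open import Data.Fin.Subset.Properties using (_∈?_; drop-there)
  open import Data.Integer using (ℤ; +_; _+_; _-_; _*_; -_; _≤_; +≤+)
  open import Data.Integer.Divisibility.Signed using (_∣_; _∣?_)
  open import Data.Integer.Properties
  open import Data.List using (List; length; map; filter; cartesianProduct; tabulate; allFin; upTo)
  open import Data.List.Membership.Propositional.Properties using (∈-upTo⁻)
  open import Data.List.Properties using (map-tabulate)
  open import Data.List.Relation.Unary.Unique.Propositional using (Unique)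
  open import Data.List.Relation.Unary.Unique.Propositional.Properties using (allFin⁺; filter⁺)
  open import Data.Nat as ℕ using (ℕ; zero; suc; z≤n; s≤s)
  open import Data.Nat.Primality using (Prime)
  open import Data.Product using (_×_; _,_)
  open import Data.Vec using ([]; _∷_; there)
  open import Function using (id; _⇔_; mk⇔; Equivalence)
  open import Relation.Binary.PropositionalEquality
  open import Relation.Nullary.Decidable using (_×-dec_)

  ∑𝟙∈≡∣∣ : ∀ {n} (U : Subset n) → (∑[ i ∈ allFin n ] 𝟙 (i ∈? U)) ≡ + ∣ U ∣
  ∑𝟙∈≡∣∣ {zero}  []      = refl
  ∑𝟙∈≡∣∣ {suc n} (s ∷ U) = trans (cong (_+_ (𝟙 (zero ∈? s ∷ U))) tail) (head s)
    where
    tail : (∑[ i ∈ tabulate suc ] 𝟙 (i ∈? s ∷ U)) ≡ + ∣ U ∣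
    tail = begin
      ∑ (tabulate suc) (λ i → 𝟙 (i ∈? s ∷ U))  ≡⟨ cong (λ is → ∑ is (λ i → 𝟙 (i ∈? s ∷ U))) (map-tabulate id suc) ⟨
      ∑ (map suc (allFin n)) (λ i → 𝟙 (i ∈? s ∷ U))      ≡⟨ ∑-map suc (allFin n) _ ⟩
      (∑[ i ∈ allFin n ] 𝟙 (suc i ∈? s ∷ U))             ≡⟨ ∑-cong (allFin n) (λ i → 𝟙-cong (suc i ∈? s ∷ U) (i ∈? U) (mk⇔ drop-there there)) ⟩
      (∑[ i ∈ allFin n ] 𝟙 (i ∈? U))                     ≡⟨ ∑𝟙∈≡∣∣ U ⟩
      + ∣ U ∣                                            ∎
      where open ≡-Reasoning
    head : ∀ s → 𝟙 (zero ∈? s ∷ U) + + ∣ U ∣ ≡ + ∣ s ∷ U ∣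
    head true  = refl
    head false = refl

  length-members : ∀ {n} (U : Subset n) → length (filter (_∈? U) (allFin n)) ≡ ∣ U ∣
  length-members {n} U = +-injective (trans (length-filter-∑ (_∈? U) (allFin n)) (∑𝟙∈≡∣∣ U))

  ∈ℤ⇔∈ : ∀ {p} (U : Subset p) i → + toℕ i ∈ℤ U ⇔ i ∈ U
  ∈ℤ⇔∈ U i = mk⇔
    (λ { (j , j∈U , i≡j) → subst (_∈ U) (sym (toℕ-injective (+-injective i≡j))) j∈U })
    (λ i∈U → i , i∈U , refl)

  module _ (p : ℕ) (p-prime : Prime p) (U V : Subset p) (h : ℕ) (h≤p : h ℕ.≤ p) (S : ℤ) (T : ℕ) where

    open Modulo p p-prime
    open Equivalence using (to; from)

    members : Subset p → List (Fin p)
    members W = filter (_∈? W) residues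

    members-unique : ∀ W → Unique (members W)
    members-unique W = filter⁺ (_∈? W) (allFin⁺ p)

    open Points (members V) (members-unique V) h h≤p

    J₂≡count : + J₂ p U V S T ≡ count (_∈? U) S T
    J₂≡count = begin
      + J₂ p U V S T
        ≡⟨ length-filter-∑ (isSolution? p U V S T) (cartesianProduct zs (cartesianProduct zs window)) ⟩
      ∑ (cartesianProduct zs (cartesianProduct zs window)) sol
        ≡⟨ ∑-cartesianProduct zs (cartesianProduct zs window) sol ⟩
      (∑[ x ∈ zs ] ∑[ yz ∈ cartesianProduct zs window ] sol (x , yz))
        ≡⟨ ∑-map val residues _ ⟩
      (∑[ i ∈ residues ] ∑[ yz ∈ cartesianProduct zs window ] sol (val i , yz))
        ≡⟨ ∑-cong residues (λ i → trans (∑-cartesianProduct zs window _) (trans (∑-map val residues _)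
             (∑-cong residues λ j → ∑-map (λ k → S + + suc k) (upTo T) (λ z → sol (val i , val j , z))))) ⟩
      (∑[ i ∈ residues ] ∑[ j ∈ residues ] ∑[ k ∈ upTo T ] sol (val i , val j , S + + suc k))
        ≡⟨ ∑-cong residues (λ i → ∑-cong residues λ j → ∑-cong-∈ (upTo T) λ k∈ → factor i j (∈-upTo⁻ k∈)) ⟩
      (∑[ i ∈ residues ] ∑[ j ∈ residues ] ∑[ k ∈ upTo T ] 𝟙 (i ∈? U) * (𝟙 (j ∈? V) * near (_∈? U) S T i j k))
        ≡⟨ ∑-cong residues (λ i → ∑-cong residues λ j → trans (sym (*-distribˡ-∑ (upTo T) (𝟙 (i ∈? U)) _)) (cong (_*_ (𝟙 (i ∈? U))) (sym (*-distribˡ-∑ (upTo T) (𝟙 (j ∈? V)) _)))) ⟩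
      (∑[ i ∈ residues ] ∑[ j ∈ residues ] 𝟙 (i ∈? U) * (𝟙 (j ∈? V) * (∑[ k ∈ upTo T ] near (_∈? U) S T i j k)))
        ≡⟨ ∑-cong residues (λ i → trans (sym (*-distribˡ-∑ residues (𝟙 (i ∈? U)) _)) (cong (_*_ (𝟙 (i ∈? U))) (sym (∑-filter (_∈? V) residues _)))) ⟩
      (∑[ i ∈ residues ] 𝟙 (i ∈? U) * (∑[ j ∈ members V ] ∑[ k ∈ upTo T ] near (_∈? U) S T i j k))
        ≡⟨ ∑-filter (_∈? U) residues _ ⟨
      count (_∈? U) S T ∎
      where
      open ≡-Reasoning
      -- These unfold to the same lists as the search box behind `solutions`, whose parts are
      -- private.
      zs window : List ℤ
      zs     = map val residues
      window = map (λ k → S + + suc k) (upTo T)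
      sol : ℤ × ℤ × ℤ → ℤ
      sol t = 𝟙 (isSolution? p U V S T t)
      -- For k < T both bounds on z hold, so only membership in U, membership in V and the
      -- congruence remain.
      factor : ∀ i j {k} → k ℕ.< T →
        sol (val i , val j , S + + suc k) ≡ 𝟙 (i ∈? U) * (𝟙 (j ∈? V) * near (_∈? U) S T i j k)
      factor i j {k} k<T = trans
        (𝟙-× (i ∈? U) ((j ∈? V) ×-dec (+ p ∣? val i * val j - (S + + suc k))) (isSolution? p U V S T (val i , val j , S + + suc k))
          (mk⇔ (λ (p∣ , i∈ , j∈ , _) → to (∈ℤ⇔∈ U i) i∈ , to (∈ℤ⇔∈ V j) j∈ , p∣)
               (λ (i∈ , j∈ , p∣) → p∣ , from (∈ℤ⇔∈ U i) i∈ , from (∈ℤ⇔∈ V j) j∈ ,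
                 +-monoʳ-≤ S (+≤+ (s≤s z≤n)) , +-monoʳ-≤ S (+≤+ k<T))))
        (cong (_*_ (𝟙 (i ∈? U))) (𝟙-× (j ∈? V) (+ p ∣? _) _ (mk⇔ id id)))

    W≡ : W (_∈? U) S T ≡ + (∣ U ∣ ℕ.* ∣ V ∣)
    W≡ = trans (cong₂ (λ a b → + a * + b) (length-members U) (length-members V)) (sym (pos-* ∣ U ∣ ∣ V ∣))

-- The choice of h, in natural-number arithmetic.

module SmoothingLength where

  open import Data.Nat
  open import Data.Nat.DivMod using (_/_; _%_; m≡m%n+[m/n]*n; m%n<n; m/n*n≤m; m≥n⇒m/n>0)
  open import Data.Nat.Properties
  open import Data.Nat.Tactic.RingSolver using (solve-∀)
  open import Data.Product using (∃-syntax; _×_; _,_)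
  open import Relation.Binary.PropositionalEquality
  open import Relation.Nullary using (yes; no)
  open ≤-Reasoning

  cube-cancel-≤ : ∀ {m n} → m ^ 3 ≤ n ^ 3 → m ≤ n
  cube-cancel-≤ m³≤n³ = ≮⇒≥ λ n<m → <⇒≱ (^-monoˡ-< 3 n<m) m³≤n³

  -- a / m and b / m bound the cube root of W² T and the square root of p W
  -- from above; h balances the boundary loss W h / p against the variance
  -- term √(p W T / h), i.e. h ≈ p T^(1/3) / W^(1/3), capped at T.
  smoothing-length : ∀ p W T m a b .{{_ : NonZero p}} .{{_ : NonZero W}} .{{_ : NonZero T}} .{{_ : NonZero m}} →
    W ≤ p * p → W ^ 2 * T * m ^ 3 ≤ a ^ 3 → p * W * m ^ 2 ≤ b ^ 2 →
    ∃[ h ] ∃[ Z ] 1 ≤ h × h ≤ T × m * W * h ≤ a * p × 4 * p * W * T * (m * m) ≤ h * (Z * Z) × Z ≤ 3 * a + 3 * b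
  smoothing-length p W T m a b W≤p² W²Tm³≤a³ pWm²≤b² with a * p / (W * m) ≤? T
    where instance Wm≢0 = m*n≢0 W m
  ... | yes H≤T = H , 3 * a , 1≤H , H≤T , mWH≤ap , variance , m≤m+n (3 * a) (3 * b)
    where
    instance Wm≢0 = m*n≢0 W m
    H = a * p / (W * m)
    -- Needed for H ≥ 1, that is, for the quotient not to round down to 0. In cubes it reduces to W
    -- ≤ p³ T, which follows from W ≤ p².
    Wm≤ap : W * m ≤ a * p
    Wm≤ap = cube-cancel-≤ (begin
      (W * m) ^ 3                              ≡⟨ cubes W m ⟩
      W * (W ^ 2 * m ^ 3)                      ≤⟨ *-monoˡ-≤ (W ^ 2 * m ^ 3) (≤-trans W≤p² (m≤m*n (p * p) (p * T) {{m*n≢0 p T}})) ⟩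
      p * p * (p * T) * (W ^ 2 * m ^ 3)        ≡⟨ regroup p T W m ⟩
      W ^ 2 * T * m ^ 3 * p ^ 3                ≤⟨ *-monoˡ-≤ (p ^ 3) W²Tm³≤a³ ⟩
      a ^ 3 * p ^ 3                            ≡⟨ product a p ⟩
      (a * p) ^ 3                              ∎)
      where
      cubes : ∀ W m → (W * m) * ((W * m) * ((W * m) * 1)) ≡ W * ((W * (W * 1)) * (m * (m * (m * 1))))
      cubes = solve-∀
      regroup : ∀ p T W m → p * p * (p * T) * ((W * (W * 1)) * (m * (m * (m * 1)))) ≡ (W * (W * 1)) * T * (m * (m * (m * 1))) * (p * (p * (p * 1)))
      regroup = solve-∀
      product : ∀ a p → (a * (a * (a * 1))) * (p * (p * (p * 1))) ≡ (a * p) * ((a * p) * ((a * p) * 1))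
      product = solve-∀
    1≤H : 1 ≤ H
    1≤H = m≥n⇒m/n>0 Wm≤ap
    mWH≤ap : m * W * H ≤ a * p
    mWH≤ap = ≤-trans (≤-reflexive (trans (*-comm (m * W) H) (cong (H *_) (*-comm m W)))) (m/n*n≤m (a * p) (W * m))
    -- Since H ≥ 1, rounding the quotient down loses at most a factor 2.
    ap≤2HWm : a * p ≤ 2 * H * (W * m)
    ap≤2HWm = begin
      a * p                                    ≡⟨ m≡m%n+[m/n]*n (a * p) (W * m) ⟩
      a * p % (W * m) + H * (W * m)            ≤⟨ +-monoˡ-≤ (H * (W * m)) (<⇒≤ (m%n<n (a * p) (W * m))) ⟩
      W * m + H * (W * m)                      ≤⟨ +-monoˡ-≤ (H * (W * m)) (m≤n*m (W * m) H {{>-nonZero 1≤H}}) ⟩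
      H * (W * m) + H * (W * m)                ≡⟨ double H (W * m) ⟩
      2 * H * (W * m)                          ∎
      where
      double : ∀ H n → H * n + H * n ≡ 2 * H * n
      double = solve-∀
    -- Multiplying by W m produces W² T m³ ≤ a³. The resulting factor 4 · 2 = 8 is raised to the
    -- square 9, hence Z = 3 a.
    variance : 4 * p * W * T * (m * m) ≤ H * (3 * a * (3 * a))
    variance = *-cancelʳ-≤ _ _ (W * m) (begin
      4 * p * W * T * (m * m) * (W * m)        ≡⟨ regroup p W T m ⟩
      4 * p * (W ^ 2 * T * m ^ 3)              ≤⟨ *-monoʳ-≤ (4 * p) W²Tm³≤a³ ⟩
      4 * p * a ^ 3                            ≡⟨ square a p ⟩
      4 * (a * a) * (a * p)                    ≤⟨ *-monoʳ-≤ (4 * (a * a)) ap≤2HWm ⟩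
      4 * (a * a) * (2 * H * (W * m))          ≤⟨ m≤m+n _ (a * a * H * (W * m)) ⟩
      4 * (a * a) * (2 * H * (W * m)) + a * a * H * (W * m) ≡⟨ nine a H (W * m) ⟩
      H * (3 * a * (3 * a)) * (W * m)          ∎)
      where
      regroup : ∀ p W T m → 4 * p * W * T * (m * m) * (W * m) ≡ 4 * p * ((W * (W * 1)) * T * (m * (m * (m * 1))))
      regroup = solve-∀
      square : ∀ a p → 4 * p * (a * (a * (a * 1))) ≡ 4 * (a * a) * (a * p)
      square = solve-∀
      nine : ∀ a H n → 4 * (a * a) * (2 * H * n) + a * a * H * n ≡ H * (3 * a * (3 * a)) * n
      nine = solve-∀
  -- The balanced length exceeds T, so h = T already has an acceptable loss. T then cancels from the
  -- variance condition, leaving 4 p W m² ≤ (2 b)², hence Z = 2 b.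
  ... | no H≰T = T , 2 * b , >-nonZero⁻¹ T , ≤-refl , mWT≤ap , variance ,
      ≤-trans (*-monoˡ-≤ b {2} {3} (s≤s (s≤s z≤n))) (m≤n+m (3 * b) (3 * a))
    where
    instance Wm≢0 = m*n≢0 W m
    H = a * p / (W * m)
    mWT≤ap : m * W * T ≤ a * p
    mWT≤ap = begin
      m * W * T                                ≡⟨ trans (*-comm (m * W) T) (cong (T *_) (*-comm m W)) ⟩
      T * (W * m)                              ≤⟨ *-monoˡ-≤ (W * m) (<⇒≤ (≰⇒> H≰T)) ⟩
      H * (W * m)                              ≤⟨ m/n*n≤m (a * p) (W * m) ⟩
      a * p                                    ∎
    variance : 4 * p * W * T * (m * m) ≤ T * (2 * b * (2 * b))
    variance = begin
      4 * p * W * T * (m * m)                  ≡⟨ regroup p W T m ⟩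
      T * (4 * (p * W * m ^ 2))                ≤⟨ *-monoʳ-≤ T (*-monoʳ-≤ 4 pWm²≤b²) ⟩
      T * (4 * b ^ 2)                          ≡⟨ square T b ⟩
      T * (2 * b * (2 * b))                    ∎
      where
      regroup : ∀ p W T m → 4 * p * W * T * (m * m) ≡ T * (4 * (p * W * (m * (m * 1))))
      regroup = solve-∀
      square : ∀ T b → T * (4 * (b * (b * 1))) ≡ T * (2 * b * (2 * b))
      square = solve-∀

-- Removing the factor h and the square from the smoothed bound.

module Descaling where

  open FiniteSums using (*-monoˡ-≤; *-nonneg)
  open import Data.Integer using (+_; 0ℤ; _+_; _*_; _≤_; +≤+; +<+; positive)
  open import Data.Integer.Properties
  open import Data.Integer.Tactic.RingSolver using (solve-∀)
  open import Data.Nat as ℕ using (z≤n; NonZero)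
  open import Relation.Binary.PropositionalEquality
  open ≤-Reasoning

  -- Gives an upper bound for the deviation from one for its square, whatever its sign.
  square-cancel-≤ : ∀ {i} n → i * i ≤ + n * + n → i ≤ + n
  square-cancel-≤ {i} n i²≤n² = ≮⇒≥ λ n<i →
    let instance i-pos = positive (≤-<-trans (+≤+ {n = n} z≤n) n<i)
    in <⇒≱ (≤-<-trans (*-monoˡ-≤-nonNeg (+ n) (<⇒≤ n<i)) (*-monoʳ-<-pos i n<i)) i²≤n²

  -- After multiplication by m the loss is at most h a p, and m E ≤ p h Z because (m E)² ≤ p² h · 4
  -- p W T m² ≤ (p h Z)². Both terms contain h, which cancels.
  descale : ∀ p W T m a Z h .{{_ : NonZero h}} {d E} →
    m ℕ.* W ℕ.* h ℕ.≤ a ℕ.* p → 4 ℕ.* p ℕ.* W ℕ.* T ℕ.* (m ℕ.* m) ℕ.≤ h ℕ.* (Z ℕ.* Z) →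
    + h * d ≤ + W * (+ h * + h) + E →
    E * E ≤ + 4 * (+ p * + p * + p) * (+ W * (+ h * + T)) →
    + m * d ≤ + (p ℕ.* (a ℕ.+ Z))
  descale p W T m a Z h {d} {E} loss variance hd≤ E²≤ = *-cancelˡ-≤-pos _ _ (+ h) {{positive (+<+ (ℕ.>-nonZero⁻¹ h))}} (begin
    + h * (+ m * d)                              ≡⟨ swap (+ h) (+ m) d ⟩
    + m * (+ h * d)                              ≤⟨ *-monoˡ-≤ (0≤+ m) hd≤ ⟩
    + m * (+ W * (+ h * + h) + E)                ≡⟨ expand (+ m) (+ W) (+ h) E ⟩
    + h * (+ m * + W * + h) + + m * E            ≤⟨ +-mono-≤ (*-monoˡ-≤ (0≤+ h) loss′) mE≤ ⟩
    + h * (+ a * + p) + + (p ℕ.* h ℕ.* Z)        ≡⟨ cong (_+_ (+ h * (+ a * + p))) (trans (pos-* (p ℕ.* h) Z) (cong (_* + Z) (pos-* p h))) ⟩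
    + h * (+ a * + p) + + p * + h * + Z          ≡⟨ collect (+ h) (+ a) (+ p) (+ Z) ⟩
    + h * (+ p * (+ a + + Z))                    ≡⟨ cong (+ h *_) (pos-* p (a ℕ.+ Z)) ⟨
    + h * + (p ℕ.* (a ℕ.+ Z))                    ∎)
    where
    0≤+ : ∀ n → 0ℤ ≤ + n
    0≤+ n = +≤+ z≤n
    swap : ∀ h m d → h * (m * d) ≡ m * (h * d)
    swap = solve-∀
    expand : ∀ m W h E → m * (W * (h * h) + E) ≡ h * (m * W * h) + m * E
    expand = solve-∀
    collect : ∀ h a p Z → h * (a * p) + p * h * Z ≡ h * (p * (a + Z))
    collect = solve-∀
    loss′ : + m * + W * + h ≤ + a * + p
    loss′ = subst₂ _≤_ (trans (pos-* (m ℕ.* W) h) (cong (_* + h) (pos-* m W))) (pos-* a p) (+≤+ loss)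
    variance′ : + 4 * + p * + W * + T * (+ m * + m) ≤ + h * (+ Z * + Z)
    variance′ = subst₂ _≤_ lhs (trans (pos-* h (Z ℕ.* Z)) (cong (+ h *_) (pos-* Z Z))) (+≤+ variance)
      where
      lhs : + (4 ℕ.* p ℕ.* W ℕ.* T ℕ.* (m ℕ.* m)) ≡ + 4 * + p * + W * + T * (+ m * + m)
      lhs = trans (pos-* (4 ℕ.* p ℕ.* W ℕ.* T) (m ℕ.* m)) (cong₂ _*_
        (trans (pos-* (4 ℕ.* p ℕ.* W) T) (cong (_* + T) (trans (pos-* (4 ℕ.* p) W) (cong (_* + W) (pos-* 4 p)))))
        (pos-* m m))
    mE≤ : + m * E ≤ + (p ℕ.* h ℕ.* Z)
    mE≤ = square-cancel-≤ (p ℕ.* h ℕ.* Z) (begin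
      + m * E * (+ m * E)                                          ≡⟨ squares (+ m) E ⟩
      + m * + m * (E * E)                                          ≤⟨ *-monoˡ-≤ (*-nonneg (0≤+ m) (0≤+ m)) E²≤ ⟩
      + m * + m * (+ 4 * (+ p * + p * + p) * (+ W * (+ h * + T)))  ≡⟨ regroup (+ m) (+ p) (+ W) (+ h) (+ T) ⟩
      + p * + p * + h * (+ 4 * + p * + W * + T * (+ m * + m))      ≤⟨ *-monoˡ-≤ (*-nonneg (*-nonneg (0≤+ p) (0≤+ p)) (0≤+ h)) variance′ ⟩
      + p * + p * + h * (+ h * (+ Z * + Z))                        ≡⟨ final (+ p) (+ h) (+ Z) ⟩
      + p * + h * + Z * (+ p * + h * + Z)                          ≡⟨ cong₂ _*_ phZ phZ ⟨
      + (p ℕ.* h ℕ.* Z) * + (p ℕ.* h ℕ.* Z)                        ∎)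
      where
      phZ : + (p ℕ.* h ℕ.* Z) ≡ + p * + h * + Z
      phZ = trans (pos-* (p ℕ.* h) Z) (cong (_* + Z) (pos-* p h))
      squares : ∀ m e → m * e * (m * e) ≡ m * m * (e * e)
      squares = solve-∀
      regroup : ∀ m p w h t → m * m * (+ 4 * (p * p * p) * (w * (h * t))) ≡ p * p * h * (+ 4 * p * w * t * (m * m))
      regroup = solve-∀
      final : ∀ p h z → p * p * h * (h * (z * z)) ≡ p * h * z * (p * h * z)
      final = solve-∀

-- The integer discrepancy bounded by integer parts of roots.

module RootBounds where

  open SmoothingLength
  open Descaling
  open import Data.Fin.Subset using (Subset; ∣_∣)
  open import Data.Fin.Subset.Properties using (_∈?_; ∣p∣≤n)
  open import Data.Integer as ℤ using (ℤ; +_; +≤+)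
  import Data.Integer.Properties as ℤP
  open import Data.Nat
  open import Data.Nat.Primality using (Prime; prime⇒nonZero)
  open import Data.Nat.Properties
  open import Data.Nat.Tactic.RingSolver using (solve-∀)
  open import Data.Product using (∃-syntax; _×_; _,_)
  open import Function using (_⟨_⟩_)
  open import Relation.Binary.PropositionalEquality
  open import Relation.Nullary using (contradiction)
  open ≤-Reasoning

  -- The argument is positive, so its integer root is at least 1 and rounding up at most doubles it.
  suc-iroot-≤ : ∀ k .{{_ : NonZero k}} a m .{{_ : NonZero a}} .{{_ : NonZero m}} →
    suc (iroot k (a * m ^ k)) ≤ 2 * iroot k (a * m ^ k)
  suc-iroot-≤ k a m with iroot k (a * m ^ k) | iroot-upper k (a * m ^ k)
  ... | suc c | _ = s≤s (m≤m+n (suc c) 0) ⟨ ≤-trans ⟩ +-monoˡ-≤ (suc c + 0) (s≤s (z≤n {c}))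
  ... | zero  | am^k<1^k = contradiction (subst (a * m ^ k <_) (^-zeroˡ k) am^k<1^k) (≤⇒≯ (>-nonZero⁻¹ (a * m ^ k) {{m*n≢0 a (m ^ k)}}))
    where instance m^k≢0 = m^n≢0 m k

  root-length : ∀ p W T m .{{_ : NonZero p}} .{{_ : NonZero T}} .{{_ : NonZero m}} → W ≤ p * p →
    ∃[ h ] ∃[ a ] ∃[ Z ] 1 ≤ h × h ≤ T × m * W * h ≤ a * p × 4 * p * W * T * (m * m) ≤ h * (Z * Z) ×
      a + Z ≤ 8 * (iroot 3 (W ^ 2 * T * m ^ 3) + iroot 2 (p * W * m ^ 2))
  -- Choosing h involves dividing by W m, so W = 0 is separate; loss and variance both vanish, and h
  -- = 1 serves.
  root-length p zero T m _ = 1 , 0 , 0 , ≤-refl , >-nonZero⁻¹ T , ≤-reflexive (loss m) , ≤-reflexive (variance p T m) , z≤n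
    where
    loss : ∀ m → m * 0 * 1 ≡ 0
    loss = solve-∀
    variance : ∀ p T m → 4 * p * 0 * T * (m * m) ≡ 0
    variance = solve-∀
  root-length p W@(suc _) T m W≤p²
    = let (h , Z , 1≤h , h≤T , loss , variance , Z≤) = smoothing-length p W T m (suc c₃) (suc c₂) W≤p²
            (<⇒≤ (iroot-upper 3 (W ^ 2 * T * m ^ 3))) (<⇒≤ (iroot-upper 2 (p * W * m ^ 2)))
      in h , suc c₃ , Z , 1≤h , h≤T , loss , variance , (begin
      suc c₃ + Z                                 ≤⟨ +-monoʳ-≤ (suc c₃) Z≤ ⟩
      -- The added `suc c₂` completes the sum to 4 times the sum of the rounded-up roots.
      suc c₃ + (3 * suc c₃ + 3 * suc c₂)         ≤⟨ m≤m+n _ (suc c₂) ⟩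
      suc c₃ + (3 * suc c₃ + 3 * suc c₂) + suc c₂ ≡⟨ collect (suc c₃) (suc c₂) ⟩
      4 * (suc c₃ + suc c₂)                      ≤⟨ *-monoʳ-≤ 4 (+-mono-≤ (suc-iroot-≤ 3 (W ^ 2 * T) m {{W²T≢0}}) (suc-iroot-≤ 2 (p * W) m {{m*n≢0 p W}})) ⟩
      4 * (2 * c₃ + 2 * c₂)                      ≡⟨ factor c₃ c₂ ⟩
      8 * (c₃ + c₂)                              ∎)
    where
    c₃ = iroot 3 (W ^ 2 * T * m ^ 3)
    c₂ = iroot 2 (p * W * m ^ 2)
    W²T≢0 = m*n≢0 (W ^ 2) T {{m^n≢0 W 2}}
    collect : ∀ a b → a + (3 * a + 3 * b) + b ≡ 4 * (a + b)
    collect = solve-∀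
    factor : ∀ a b → 4 * (2 * a + 2 * b) ≡ 8 * (a + b)
    factor = solve-∀

  module _ (p : ℕ) (p-prime : Prime p) (U V : Subset p) (S : ℤ) (T : ℕ) (1≤T : 1 ≤ T) (T≤p : T ≤ p) where

    private
      u v : ℕ
      u = ∣ U ∣
      v = ∣ V ∣

    discrepancy : ℤ
    discrepancy = + p ℤ.* + J₂ p U V S T ℤ.- + (u * v) ℤ.* + T

    scaled-bound : ℕ → ℕ
    scaled-bound m = p * (8 * (iroot 3 ((u * v) ^ 2 * T * m ^ 3) + iroot 2 (p * (u * v) * m ^ 2)))

    -- Division by p m turns the two inequalities into a bound for |J₂ - u v T / p| by 8 times the
    -- sum of the two root approximations with denominator m.
    discrepancy-bound : ∀ m .{{_ : NonZero m}} →
      + m ℤ.* discrepancy ℤ.≤ + scaled-bound m × + m ℤ.* ℤ.- discrepancy ℤ.≤ + scaled-bound m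
    discrepancy-bound m
      using h , a , Z , 1≤h , h≤T , loss , variance , a+Z≤ ← root-length p (u * v) T m
              {{prime⇒nonZero p-prime}} {{>-nonZero 1≤T}} (*-mono-≤ (∣p∣≤n U) (∣p∣≤n V))
      = let
          h≤p = ≤-trans h≤T T≤p
          open Incidences.Modulo p p-prime
          open Points (SolutionCount.members p p-prime U V h h≤p S T V)
                      (SolutionCount.members-unique p p-prime U V h h≤p S T V) h h≤p
          W≡     = SolutionCount.W≡ p p-prime U V h h≤p S T
          J₂≡    = SolutionCount.J₂≡count p p-prime U V h h≤p S T
          D≡     = cong₂ (λ c w → + p ℤ.* c ℤ.- w ℤ.* + T) (sym J₂≡) W≡
          finish : ∀ {d} → SmoothedBound (_∈? U) S T d → + m ℤ.* d ℤ.≤ + scaled-bound m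
          finish = λ (E , hd≤ , E²≤) → ℤP.≤-trans
            (descale p (u * v) T m a Z h {{>-nonZero 1≤h}} loss variance
              (subst (λ w → + h ℤ.* _ ℤ.≤ w ℤ.* (+ h ℤ.* + h) ℤ.+ E) W≡ hd≤)
              (subst (λ w → E ℤ.* E ℤ.≤ + 4 ℤ.* (+ p ℤ.* + p ℤ.* + p) ℤ.* (w ℤ.* (+ h ℤ.* + T))) W≡ E²≤))
            (+≤+ (*-monoʳ-≤ p a+Z≤))
        in subst (λ d → + m ℤ.* d ℤ.≤ + scaled-bound m) D≡ (finish (excess-upper (_∈? U) S T h≤T T≤p)) ,
           subst (λ d → + m ℤ.* ℤ.- d ℤ.≤ + scaled-bound m) D≡ (finish (excess-lower (_∈? U) S T h≤T T≤p))

-- Fractions: passing from integer inequalities to rational ones.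

module RationalBound where

  open import Data.Integer as ℤ using (+_)
  import Data.Integer.Properties as ℤP
  open import Data.Integer.Tactic.RingSolver using (solve-∀)
  open import Data.Nat as ℕ using (suc; NonZero)
  open import Data.Rational hiding (NonZero)
  open import Data.Rational.Properties
  open import Data.Rational.Unnormalised as ℚᵘ using (mkℚᵘ; *≡*)
  import Data.Rational.Unnormalised.Properties as ℚᵘP
  open import Data.Sum using (inj₁; inj₂)
  open import Relation.Binary.PropositionalEquality using (_≡_; sym; trans; subst; subst₂)

  toℚᵘ-/ : ∀ i n .{{_ : NonZero n}} → toℚᵘ (i / n) ℚᵘ.≃ i ℚᵘ./ n
  toℚᵘ-/ i n@(suc _) = toℚᵘ-fromℚᵘ (mkℚᵘ i _)

  /-mono-≤ : ∀ i j m n .{{_ : NonZero m}} .{{_ : NonZero n}} → i ℤ.* + n ℤ.≤ j ℤ.* + m → i / m ≤ j / n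
  /-mono-≤ i j m@(suc _) n@(suc _) h = toℚᵘ-cancel-≤ (begin
    toℚᵘ (i / m) ≃⟨ toℚᵘ-/ i m ⟩
    i ℚᵘ./ m     ≤⟨ ℚᵘ.*≤* h ⟩
    j ℚᵘ./ n     ≃⟨ toℚᵘ-/ j n ⟨
    toℚᵘ (j / n) ∎)
    where open ℚᵘP.≤-Reasoning

  /1-/ : ∀ i j n .{{_ : NonZero n}} → i / 1 - j / n ≡ (+ n ℤ.* i ℤ.- j) / n
  /1-/ i j n@(suc _) = toℚᵘ-injective (begin
    toℚᵘ (i / 1 - j / n)                  ≈⟨ toℚᵘ-homo-+ (i / 1) (- (j / n)) ⟩
    toℚᵘ (i / 1) ℚᵘ.+ toℚᵘ (- (j / n))    ≈⟨ ℚᵘP.+-cong (toℚᵘ-/ i 1) (ℚᵘP.≃-trans (toℚᵘ-homo‿- (j / n)) (ℚᵘP.-‿cong (toℚᵘ-/ j n))) ⟩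
    i ℚᵘ./ 1 ℚᵘ.- j ℚᵘ./ n                ≈⟨ *≡* (cross i j (+ n)) ⟩
    (+ n ℤ.* i ℤ.- j) ℚᵘ./ n              ≈⟨ toℚᵘ-/ (+ n ℤ.* i ℤ.- j) n ⟨
    toℚᵘ ((+ n ℤ.* i ℤ.- j) / n)          ∎)
    where
    open ℚᵘP.≃-Reasoning
    cross : ∀ i j n → (i ℤ.* n ℤ.+ ℤ.- j ℤ.* + 1) ℤ.* n ≡ (n ℤ.* i ℤ.- j) ℤ.* (+ 1 ℤ.* n)
    cross = solve-∀

  /1*[/+/] : ∀ c i j n .{{_ : NonZero n}} → c / 1 * (i / n + j / n) ≡ (c ℤ.* (i ℤ.+ j)) / n
  /1*[/+/] c i j n@(suc _) = toℚᵘ-injective (begin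
    toℚᵘ (c / 1 * (i / n + j / n))           ≈⟨ toℚᵘ-homo-* (c / 1) (i / n + j / n) ⟩
    toℚᵘ (c / 1) ℚᵘ.* toℚᵘ (i / n + j / n)   ≈⟨ ℚᵘP.*-cong (toℚᵘ-/ c 1) (ℚᵘP.≃-trans (toℚᵘ-homo-+ (i / n) (j / n)) (ℚᵘP.+-cong (toℚᵘ-/ i n) (toℚᵘ-/ j n))) ⟩
    c ℚᵘ./ 1 ℚᵘ.* (i ℚᵘ./ n ℚᵘ.+ j ℚᵘ./ n)   ≈⟨ *≡* (cross c i j (+ n)) ⟩
    (c ℤ.* (i ℤ.+ j)) ℚᵘ./ n                 ≈⟨ toℚᵘ-/ (c ℤ.* (i ℤ.+ j)) n ⟨
    toℚᵘ ((c ℤ.* (i ℤ.+ j)) / n)             ∎)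
    where
    open ℚᵘP.≃-Reasoning
    cross : ∀ c i j n → c ℤ.* (i ℤ.* n ℤ.+ j ℤ.* n) ℤ.* n ≡ c ℤ.* (i ℤ.+ j) ℤ.* (+ 1 ℤ.* (n ℤ.* n))
    cross = solve-∀

  -‿/ : ∀ i n .{{_ : NonZero n}} → - (i / n) ≡ (ℤ.- i) / n
  -‿/ i n@(suc _) = toℚᵘ-injective (begin
    toℚᵘ (- (i / n))     ≈⟨ toℚᵘ-homo‿- (i / n) ⟩
    ℚᵘ.- toℚᵘ (i / n)    ≈⟨ ℚᵘP.-‿cong (toℚᵘ-/ i n) ⟩
    ℚᵘ.- (i ℚᵘ./ n)      ≈⟨ toℚᵘ-/ (ℤ.- i) n ⟨
    toℚᵘ ((ℤ.- i) / n)   ∎)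
    where open ℚᵘP.≃-Reasoning

  ∣/∣-≤ : ∀ d b p m .{{_ : NonZero p}} .{{_ : NonZero m}} →
    + m ℤ.* d ℤ.≤ + p ℤ.* b → + m ℤ.* ℤ.- d ℤ.≤ + p ℤ.* b → ∣ d / p ∣ ≤ b / m
  ∣/∣-≤ d b p m hi lo with ∣p∣≡p∨∣p∣≡-p (d / p)
  ... | inj₁ e = subst (_≤ b / m) (sym e) (/-mono-≤ d b p m (subst₂ ℤ._≤_ (ℤP.*-comm (+ m) d) (ℤP.*-comm (+ p) b) hi))
  ... | inj₂ e = subst (_≤ b / m) (sym (trans e (-‿/ d p)))
    (/-mono-≤ (ℤ.- d) b p m (subst₂ ℤ._≤_ (ℤP.*-comm (+ m) (ℤ.- d)) (ℤP.*-comm (+ p) b) lo))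

  ≤-+-pos : ∀ {x y ε} → 0ℚ < ε → x ≤ y → x ≤ y + ε
  ≤-+-pos {x} {y} {ε} 0<ε x≤y = subst (_≤ y + ε) (+-identityʳ x) (+-mono-≤ x≤y (<⇒≤ 0<ε))

-- The inequality between reals, read off from the approximating sequences.

open import Data.Fin.Subset using (Subset; ∣_∣)
open import Data.Integer using (ℤ; +_)
open import Data.Nat using (ℕ; _*_; _^_; _≤_)
open import Data.Nat.Primality using (Prime; prime⇒nonZero)
open import Data.Product using (∃-syntax; _×_)
open import Data.Rational using (_/_)

theorem3 :
    ∃[ C ] 0ℝ <ℝ C ×
      (∀ (p : ℕ) (p-prime : Prime p) (U V : Subset p) (S : ℤ) (T : ℕ) → 1 ≤ T → T ≤ p →
        let u = ∣ U ∣
            v = ∣ V ∣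
            uvT/p = fromℚ ((+ (u * v * T) / p) {{prime⇒nonZero p-prime}})
        in
        ∣ fromℕ (J₂ p U V S T) -ℝ uvT/p ∣ℝ
          ≤ℝ C *ℝ (root 3 (u ^ 2 * v ^ 2 * T) +ℝ root 2 (p * u * v)))
theorem3 = fromℕ 8 , (1ℚ , ℚP.positive⁻¹ 1ℚ , 0 , λ _ _ → toWitness {a? = 0ℚ ℚ.+ 1ℚ ℚP.≤? + 8 / 1} _) ,
  λ p p-prime U V S T 1≤T T≤p ε 0<ε → 0 , λ n _ →
    -- The inequality holds at every index, so the threshold is 0 and ε is simply added.
    ≤-+-pos 0<ε (bound p p-prime U V S T 1≤T T≤p n)
  where
  open RootBounds
  open RationalBound
  open import Data.Integer as ℤ using ()
  import Data.Integer.Properties as ℤP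
  import Data.Nat.Tactic.RingSolver as ℕ-Solver
  open import Data.Nat using (suc; _+_)
  open import Data.Product using (_,_; proj₁; proj₂)
  open import Data.Rational as ℚ using (0ℚ; 1ℚ)
  import Data.Rational.Properties as ℚP
  open import Relation.Binary.PropositionalEquality using (_≡_; trans; cong; cong₂; subst)
  open import Relation.Nullary.Decidable using (toWitness)

  -- Compares the n-th terms of the two sides of the theorem, with the sequences of `root` unfolded.
  bound : ∀ p (p-prime : Prime p) (U V : Subset p) S T → 1 ≤ T → T ≤ p → ∀ n →
    let instance p≢0 = prime⇒nonZero p-prime
        u = ∣ U ∣
        v = ∣ V ∣
    in ℚ.∣ + J₂ p U V S T / 1 ℚ.- + (u * v * T) / p ∣ ℚ.≤
       + 8 / 1 ℚ.* (+ iroot 3 (u ^ 2 * v ^ 2 * T * suc n ^ 3) / suc n ℚ.+ + iroot 2 (p * u * v * suc n ^ 2) / suc n)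
  bound p p-prime U V S T 1≤T T≤p n = begin
    ℚ.∣ + N / 1 ℚ.- + (u * v * T) / p ∣     ≡⟨ cong ℚ.∣_∣ (/1-/ (+ N) (+ (u * v * T)) p) ⟩
    ℚ.∣ (+ p ℤ.* + N ℤ.- + (u * v * T)) / p ∣ ≡⟨ cong (λ t → ℚ.∣ (+ p ℤ.* + N ℤ.- t) / p ∣) (ℤP.pos-* (u * v) T) ⟩
    ℚ.∣ D / p ∣                             ≤⟨ ∣/∣-≤ D (+ 8 ℤ.* (+ c₃ ℤ.+ + c₂)) p m (rescale (proj₁ bounds)) (rescale (proj₂ bounds)) ⟩
    (+ 8 ℤ.* (+ c₃ ℤ.+ + c₂)) / m           ≡⟨ /1*[/+/] (+ 8) (+ c₃) (+ c₂) m ⟨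
    + 8 / 1 ℚ.* (+ c₃ / m ℚ.+ + c₂ / m)     ≡⟨ cong₂ (λ a b → + 8 / 1 ℚ.* (+ iroot 3 a / m ℚ.+ + iroot 2 b / m))
                                                (cubes u v T (m ^ 3)) (squares p u v (m ^ 2)) ⟩
    + 8 / 1 ℚ.* (+ iroot 3 (u ^ 2 * v ^ 2 * T * m ^ 3) / m ℚ.+ + iroot 2 (p * u * v * m ^ 2) / m) ∎
    where
    open ℚP.≤-Reasoning
    instance p≢0 = prime⇒nonZero p-prime
    u = ∣ U ∣
    v = ∣ V ∣
    m = suc n
    N = J₂ p U V S T
    D = discrepancy p p-prime U V S T 1≤T T≤p
    c₃ = iroot 3 ((u * v) ^ 2 * T * m ^ 3)
    c₂ = iroot 2 (p * (u * v) * m ^ 2)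
    bounds = discrepancy-bound p p-prime U V S T 1≤T T≤p m
    cubes : ∀ u v T k → (u * v * (u * v * 1)) * T * k ≡ (u * (u * 1)) * (v * (v * 1)) * T * k
    cubes = ℕ-Solver.solve-∀
    squares : ∀ p u v k → p * (u * v) * k ≡ p * u * v * k
    squares = ℕ-Solver.solve-∀
    rescale : ∀ {i} → i ℤ.≤ + (p * (8 * (c₃ + c₂))) → i ℤ.≤ + p ℤ.* (+ 8 ℤ.* (+ c₃ ℤ.+ + c₂))
    rescale = subst (_ ℤ.≤_) (trans (ℤP.pos-* p _) (cong (ℤ._*_ (+ p)) (ℤP.pos-* 8 (c₃ + c₂))))
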